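{- Let $A$ be a set and let $(K,+,e,\sqsubseteq)$ be an ordered commutative monoid. Let $f\colon X\to Y$ be a lax homomorphism between pointed $K^{(A\times -)}$-coalgebras. (1) If $f$ is $(\mathbb{E}_K,\mathbb{S}_K)$-open, $X$ is reachable and $K$ is positively ordered, then $f$ is a proper homomorphism. (2) Conversely, if $f$ is a proper homomorphism and $K$ is a rearrangement monoid, then $f$ is $(\mathbb{E}_K,\mathbb{S}_K)$-open. (3) In particular, if $K$ is a positively ordered rearrangement monoid, then two pointed $K^{(A\times -)}$-coalgebras $X$ and $Y$ are $(\mathbb{E}_K,\mathbb{S}_K)$-bisimilar if and only if they are coalgebraically bisimilar.
   Context: Ordered commutative monoid $(K,+,e,\sqsubseteq)$: a commutative monoid with a partial order for which $+$ is monotone in both arguments. It is positively ordered if $e\sqsubseteq k$ for all $k\in K$. It is a rearrangement monoid if for all $n,m\ge1$ and $x_1,\dots,x_n,y_1,\dots,y_m\in K$ with $\sum_i x_i\sqsubseteq\sum_j y_j$ there is a family $(u_{i,j})_{1\le i\le n,1\le j\le m}$ in $K$ with $\sum_i u_{i,j}\sqsubseteq y_j$ for all $j$ and $\sum_j u_{i,j}=x_i$ for all $i$. $K^{(X)}$ is the set of maps $\mu\colon X\to K$ with $\mu(x)\neq e$ for only finitely many $x$; on maps, $K^{(f)}(\mu)(y)=\sum_{f(x)=y}\mu(x)$. Let $F=K^{(A\times -)}$. A pointed coalgebra $(X,c,x_0)$ is a set $X$, a map $c\colon X\to FX$ and $x_0\in X$. Maps $X\to FY$ are ordered pointwise: $f_1\sqsubseteq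 f_2$ iff $f_1(x)(a,y)\sqsubseteq f_2(x)(a,y)$ for all $x,a,y$. A lax homomorphism $(X,c,x_0)\to(Y,d,y_0)$ is a map $f\colon X\to Y$ with $f(x_0)=y_0$ and $Ff\circ c\sqsubseteq d\circ f$; it is proper if $Ff\circ c=d\circ f$. $\mathsf{LCoalg}(1,F)$ is the category of pointed coalgebras and lax homomorphisms. $X,Y$ are coalgebraically bisimilar if there are $Z$ and proper homomorphisms $Z\to X$, $Z\to Y$. Generalized open maps: the data are a category $\mathbb{M}$, a set $V$ with $J\colon V\to\mathrm{ob}(\mathbb{M})$, small categories $\mathbb{E},\mathbb{S}$ with object set $V$, and functors $J_{\mathbb{E}}\colon\mathbb{E}\to\mathbb{M}$, $J_{\mathbb{S}}\colon\mathbb{S}\to\mathbb{M}$ coinciding with $J$ on objects. A morphism $f\colon X\to Y$ of $\mathbb{M}$ is $(\mathbb{E},\mathbb{S})$-open if for every $\epsilon\colon v\to w$ in $\mathbb{E}$ and all $x\colon Jv\to X$, $y\colon Jw\to Y$ in $\mathbb{M}$ with $y\circ J_{\mathbb{E}}\epsilon=f\circ x$ there are $u\in V$, $\epsilon'\colon v\to u$ in $\mathbb{E}$, $s\colon u\to w$ in $\mathbb{S}$, $x'\colon Ju\to X$ in $\mathbb{M}$ with $J_{\mathbb{S}}s\circ J_{\mathbb{E}}\epsilon'=J_{\mathbb{E}}\epsilon$, $x'\circ J_{\mathbb{E}}\epsilon'=x$, $f\circ x'=y\circ J_{\mathbb{S}}s$. $X,Y$ are $(\mathbb{E},\mathbb{S})$-bisimilar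 if there are $Z$ and $(\mathbb{E},\mathbb{S})$-open maps $Z\to X$, $Z\to Y$. The data $(\mathbb{E}_K,\mathbb{S}_K)$ on $\mathbb{M}=\mathsf{LCoalg}(1,F)$: the set $V_K$ consists of all finite words $w=(a_1,k_1)\cdots(a_n,k_n)$ over $A\times(K\setminus\{e\})$, and all triples $(w_1,b,w_2)$ with $w_1$ such a word, $b\in A$, and $w_2=l_1\cdots l_m$ a non-empty word over $K\setminus\{e\}$. $Jw$ has states $0,\dots,n$, initial state $0$, and weight $k_{i+1}$ from $i$ to $i+1$ with letter $a_{i+1}$ ($0\le i<n$), all other weights being $e$. $J(w_1,b,w_2)$, with $w_1$ of length $n$, has states $0,\dots,n$ and $(n+1,1),\dots,(n+1,m)$, initial state $0$, the transitions of $Jw_1$ together with weight $l_i$ from $n$ to $(n+1,i)$ with letter $b$ for $1\le i\le m$, all other weights being $e$. $\mathbb{E}_K$ has as non-identity morphisms exactly one morphism $w_1\to(w_1,b,w_2)$ for all $w_1,b,w_2$; $J_{\mathbb{E}}$ sends it to the inclusion of states. $\mathbb{S}_K$ has identities on words, and morphisms $(w_1,b,l'_1\cdots l'_{m'})\to(w_1,b,l_1\cdots l_m)$ (with $m\le m'$) given by the monotone surjections $s\colon\{1,\dots,m'\}\to\{1,\dots,m\}$ with $l_i=\sum_{s(j)=i}l'_j$ for all $i$; $J_{\mathbb{S}}s$ maps $i\mapsto i$ and $(n+1,j)\mapsto(n+1,s(j))$. A state $p$ of $X$ is reachable if there are a word $w$ over $A\times(K\setminus\{e\})$, of length $n$,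 and a lax homomorphism $x\colon Jw\to X$ with $x(n)=p$; $X$ is reachable if all its states are.
   Formalization: In (2) it is additionally assumed that the inclusions Jw₁ → J(w₁,b,w₂) are lax homomorphisms, so that J_E is a functor into LCoalg(1,F); this holds exactly when K is positively ordered or A is empty, and otherwise "open" is undefined. -}

module Defs where

open import Algebra.Bundles using (CommutativeMonoid)
open import Axiom.ExcludedMiddle using (ExcludedMiddle)
open import Data.Bool.Base using (true; false; if_then_else_)
open import Data.Empty using (⊥-elim)
open import Data.Fin.Base as Fin using (Fin; inject₁; fromℕ)
import Data.Fin.Properties as Fin
open import Data.List.Base using (List; []; _∷_; _++_; map; filter; foldr; length; lookup; allFin; deduplicate)
open import Data.List.Membership.Propositional using (_∈_; _∉_)
open import Data.List.Membership.Propositional.Properties using (∈-map⁺; ∈-allFin; ∈-deduplicate⁺; ∈-deduplicate⁻; ∈-++⁺ˡ; ∈-++⁺ʳ)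
open import Data.List.NonEmpty.Base using (List⁺; toList)
open import Data.List.Relation.Unary.All as All using (All)
open import Data.List.Relation.Unary.Any using (here; there)
open import Data.List.Relation.Unary.AllPairs using (_∷_)
open import Data.List.Relation.Unary.Unique.Propositional using (Unique)
import Data.List.Relation.Unary.Unique.Propositional.Properties as Unique
open import Data.List.Relation.Unary.Unique.DecPropositional.Properties using (deduplicate-!)
open import Data.Nat.Base using (ℕ; _≥_)
open import Data.Product.Base using (Σ-syntax; _×_; _,_; proj₁; proj₂; map₂)
open import Function.Base using (_∘′_) renaming (id to idf)
open import Function.Definitions using (Surjective)
import Function.Construct.Composition as Composition
open import Level using (Level; _⊔_) renaming (suc to lsuc)
open import Relation.Binary.Core using (Rel; _Preserves₂_⟶_⟶_)
open import Relation.Binary.Bundles using (Poset)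
open import Relation.Binary.Definitions using (DecidableEquality)
open import Relation.Binary.Structures using (IsEquivalence; IsPartialOrder)
open import Relation.Binary.PropositionalEquality as ≡ using (_≡_; _≢_; refl)
open import Relation.Nullary using (¬_; Dec; yes; no; does)

private
  variable
    i p : Level

record OrderedCommutativeMonoid (ℓ : Level) : Set (lsuc ℓ) where
  field
    commutativeMonoid : CommutativeMonoid ℓ ℓ

  open CommutativeMonoid commutativeMonoid public
    renaming
      ( _∙_ to _+_; ε to e; ∙-cong to +-cong; ∙-congˡ to +-congˡ; ∙-congʳ to +-congʳ
      ; assoc to +-assoc; comm to +-comm; identityˡ to +-identityˡ; identityʳ to +-identityʳ
      ; refl to ≈-refl; sym to ≈-sym; trans to ≈-trans; reflexive to ≈-reflexive )

  infix 4 _⊑_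
  field
    _⊑_            : Rel Carrier ℓ
    isPartialOrder : IsPartialOrder _≈_ _⊑_
    +-mono         : _+_ Preserves₂ _⊑_ ⟶ _⊑_ ⟶ _⊑_

  poset : Poset ℓ ℓ ℓ
  poset = record { isPartialOrder = isPartialOrder }

  open IsPartialOrder isPartialOrder public
    using () renaming (refl to ⊑-refl; reflexive to ⊑-reflexive; trans to ⊑-trans; antisym to ⊑-antisym)

module _ {ℓ : Level} (K : OrderedCommutativeMonoid ℓ) where
  open OrderedCommutativeMonoid K
  open import Algebra.Properties.CommutativeMonoid.Sum commutativeMonoid using (sum)

  PositivelyOrdered : Set ℓ
  PositivelyOrdered = ∀ k → e ⊑ k

  IsRearrangementMonoid : Set ℓ
  IsRearrangementMonoid =
    ∀ (n m : ℕ) → n ≥ 1 → m ≥ 1 →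
    (x : Fin n → Carrier) (y : Fin m → Carrier) → sum x ⊑ sum y →
    Σ[ u ∈ (Fin n → Fin m → Carrier) ]
      (∀ j → sum (λ i → u i j) ⊑ y j) × (∀ i → sum (u i) ≈ x i)

-- Hom-sets carry an explicit equality _≋_, as in agda-categories.
record CategoryOn {o : Level} (Obj : Set o) (h q : Level) : Set (o ⊔ lsuc (h ⊔ q)) where
  infix  4 _⇒_ _≋_
  infixr 9 _∘_
  field
    _⇒_           : Obj → Obj → Set h
    _≋_           : ∀ {x y} → Rel (x ⇒ y) q
    id            : ∀ {x} → x ⇒ x
    _∘_           : ∀ {x y z} → y ⇒ z → x ⇒ y → x ⇒ z
    ≋-equivalence : ∀ {x y} → IsEquivalence (_≋_ {x} {y})
    ∘-assoc       : ∀ {w x y z} {f : y ⇒ z} {g : x ⇒ y} {h : w ⇒ x} → (f ∘ g) ∘ h ≋ f ∘ (g ∘ h)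
    ∘-identityˡ   : ∀ {x y} {f : x ⇒ y} → id ∘ f ≋ f
    ∘-identityʳ   : ∀ {x y} {f : x ⇒ y} → f ∘ id ≋ f
    ∘-cong        : ∀ {x y z} {f f′ : y ⇒ z} {g g′ : x ⇒ y} → f ≋ f′ → g ≋ g′ → f ∘ g ≋ f′ ∘ g′

-- A functor whose action on objects is the given map J.
record FunctorOver {o o′ h h′ q q′ : Level} {V : Set o} {Obj : Set o′}
                   (C : CategoryOn V h q) (M : CategoryOn Obj h′ q′) (J : V → Obj)
                   : Set (o ⊔ h ⊔ q ⊔ h′ ⊔ q′) where
  private
    module C = CategoryOn C
    module M = CategoryOn M
  field
    F₁     : ∀ {v w} → v C.⇒ w → J v M.⇒ J w
    F-cong : ∀ {v w} {f g : v C.⇒ w} → f C.≋ g → F₁ f M.≋ F₁ g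
    F-id   : ∀ {v} → F₁ (C.id {v}) M.≋ M.id
    F-∘    : ∀ {u v w} {f : v C.⇒ w} {g : u C.⇒ v} → F₁ (f C.∘ g) M.≋ F₁ f M.∘ F₁ g

record OpenMapData {o h q : Level} {Obj : Set o} (M : CategoryOn Obj h q) (v : Level)
                   : Set (o ⊔ h ⊔ q ⊔ lsuc v) where
  field
    V  : Set v
    J  : V → Obj
    E  : CategoryOn V v v
    S  : CategoryOn V v v
    JE : FunctorOver E M J
    JS : FunctorOver S M J

module _ {o h q v : Level} {Obj : Set o} {M : CategoryOn Obj h q} (D : OpenMapData M v) where
  open CategoryOn M
  open OpenMapData D
  private
    module E = CategoryOn E
    module S = CategoryOn S
    module JE = FunctorOver JE
    module JS = FunctorOver JS

  IsOpen : ∀ {X Y} → X ⇒ Y → Set (h ⊔ q ⊔ v)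
  IsOpen {X} {Y} f =
    ∀ {v w} (ϵ : v E.⇒ w) (x : J v ⇒ X) (y : J w ⇒ Y) → y ∘ JE.F₁ ϵ ≋ f ∘ x →
    Σ[ u ∈ V ] Σ[ ϵ′ ∈ v E.⇒ u ] Σ[ s ∈ u S.⇒ w ] Σ[ x′ ∈ J u ⇒ X ]
      (JS.F₁ s ∘ JE.F₁ ϵ′ ≋ JE.F₁ ϵ) × (x′ ∘ JE.F₁ ϵ′ ≋ x) × (f ∘ x′ ≋ y ∘ JS.F₁ s)

  Bisimilar : Obj → Obj → Set (o ⊔ h ⊔ q ⊔ v)
  Bisimilar X Y = Σ[ Z ∈ Obj ] (Σ[ f ∈ Z ⇒ X ] IsOpen f) × (Σ[ g ∈ Z ⇒ Y ] IsOpen g)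

-- Excluded middle provides the case distinctions "f x = y" that sums over
-- fibres require for arbitrary sets X and Y.
module Theory {ℓ : Level} (em : ExcludedMiddle ℓ) (A : Set ℓ) (K : OrderedCommutativeMonoid ℓ) where
  open OrderedCommutativeMonoid K
  open import Relation.Binary.Reasoning.Setoid setoid

  private
    variable
      X Y Z : Set ℓ
      I I′ : Set i
      P Q : Set p

  infix 4 _≟_
  _≟_ : DecidableEquality X
  _ ≟ _ = em

  ∑ : List I → (I → Carrier) → Carrier
  ∑ xs g = foldr (λ x r → g x + r) e xs

  -- Iverson bracket: k if P holds, and e otherwise.
  when : Dec P → Carrier → Carrier
  when d k = if does d then k else e

  when-yes : (d : Dec P) {k : Carrier} → P → when d k ≈ k
  when-yes (yes _) _ = ≈-refl
  when-yes (no ¬p) p = ⊥-elim (¬p p)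

  when-no : (d : Dec P) {k : Carrier} → ¬ P → when d k ≈ e
  when-no (yes p) ¬p = ⊥-elim (¬p p)
  when-no (no _)  _  = ≈-refl

  when-e : (d : Dec P) {k : Carrier} → k ≈ e → when d k ≈ e
  when-e (yes _) k≈e = k≈e
  when-e (no _)  _   = ≈-refl

  when-cong : (d : Dec P) {k l : Carrier} → k ≈ l → when d k ≈ when d l
  when-cong (yes _) k≈l = k≈l
  when-cong (no _)  _   = ≈-refl

  when-mono : (d : Dec P) {k l : Carrier} → k ⊑ l → when d k ⊑ when d l
  when-mono (yes _) k⊑l = k⊑l
  when-mono (no _)  _   = ⊑-refl

  when-⇔ : (d : Dec P) (d′ : Dec Q) {k l : Carrier} → (P → Q) → (Q → P) → k ≈ l → when d k ≈ when d′ l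
  when-⇔ (yes p) d′ f _ k≈l = ≈-trans k≈l (≈-sym (when-yes d′ (f p)))
  when-⇔ (no ¬p) d′ _ g _   = ≈-sym (when-no d′ (λ q → ¬p (g q)))

  when-comm : (d : Dec P) (d′ : Dec Q) {k : Carrier} → when d (when d′ k) ≈ when d′ (when d k)
  when-comm (yes _) _  = ≈-refl
  when-comm (no _)  d′ = ≈-sym (when-e d′ ≈-refl)

  ∑-cong : (xs : List I) {g h : I → Carrier} → (∀ {x} → x ∈ xs → g x ≈ h x) → ∑ xs g ≈ ∑ xs h
  ∑-cong []       _   = ≈-refl
  ∑-cong (x ∷ xs) g≈h = +-cong (g≈h (here refl)) (∑-cong xs (λ x∈ → g≈h (there x∈)))

  ∑-mono : (xs : List I) {g h : I → Carrier} → (∀ x → g x ⊑ h x) → ∑ xs g ⊑ ∑ xs h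
  ∑-mono []       _   = ⊑-refl
  ∑-mono (x ∷ xs) g⊑h = +-mono (g⊑h x) (∑-mono xs g⊑h)

  ∑-e : (xs : List I) {g : I → Carrier} → (∀ {x} → x ∈ xs → g x ≈ e) → ∑ xs g ≈ e
  ∑-e []       _   = ≈-refl
  ∑-e (x ∷ xs) g≈e = ≈-trans (+-cong (g≈e (here refl)) (∑-e xs (λ x∈ → g≈e (there x∈)))) (+-identityˡ e)

  ∑-++ : (xs ys : List I) {g : I → Carrier} → ∑ (xs ++ ys) g ≈ ∑ xs g + ∑ ys g
  ∑-++ []       ys = ≈-sym (+-identityˡ _)
  ∑-++ (x ∷ xs) ys = ≈-trans (+-congˡ (∑-++ xs ys)) (≈-sym (+-assoc _ _ _))

  ∑-map : (f : I → I′) (xs : List I) {g : I′ → Carrier} → ∑ (map f xs) g ≈ ∑ xs (λ x → g (f x))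
  ∑-map f []       = ≈-refl
  ∑-map f (x ∷ xs) = +-congˡ (∑-map f xs)

  ∑-+ : (xs : List I) {g h : I → Carrier} → ∑ xs (λ x → g x + h x) ≈ ∑ xs g + ∑ xs h
  ∑-+ []                 = ≈-sym (+-identityˡ e)
  ∑-+ (x ∷ xs) {g} {h} = begin
    (g x + h x) + ∑ xs (λ z → g z + h z)  ≈⟨ +-congˡ (∑-+ xs) ⟩
    (g x + h x) + (∑ xs g + ∑ xs h)       ≈⟨ +-assoc _ _ _ ⟩
    g x + (h x + (∑ xs g + ∑ xs h))       ≈⟨ +-congˡ (+-assoc _ _ _) ⟨
    g x + ((h x + ∑ xs g) + ∑ xs h)       ≈⟨ +-congˡ (+-congʳ (+-comm _ _)) ⟩
    g x + ((∑ xs g + h x) + ∑ xs h)       ≈⟨ +-congˡ (+-assoc _ _ _) ⟩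
    g x + (∑ xs g + (h x + ∑ xs h))       ≈⟨ +-assoc _ _ _ ⟨
    (g x + ∑ xs g) + (h x + ∑ xs h)       ∎

  ∑-swap : (xs : List I) (ys : List I′) {g : I → I′ → Carrier} →
           ∑ xs (λ x → ∑ ys (g x)) ≈ ∑ ys (λ y → ∑ xs (λ x → g x y))
  ∑-swap []       ys = ≈-sym (∑-e ys (λ _ → ≈-refl))
  ∑-swap (x ∷ xs) ys = ≈-trans (+-congˡ (∑-swap xs ys)) (≈-sym (∑-+ ys))

  when-∑ : (d : Dec P) (xs : List I) {g : I → Carrier} → when d (∑ xs g) ≈ ∑ xs (λ x → when d (g x))
  when-∑ (yes _) xs = ≈-refl
  when-∑ (no _)  xs = ≈-sym (∑-e xs (λ _ → ≈-refl))

  ∑-δ : {xs : List I} {x : I} {h : I → Carrier} →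
        Unique xs → x ∈ xs → (∀ z → z ≢ x → h z ≈ e) → ∑ xs h ≈ h x
  ∑-δ {xs = y ∷ xs} (y∉ ∷ _) (here refl) h≈e =
    ≈-trans (+-congˡ (∑-e xs (λ {z} z∈ → h≈e z (λ z≡y → All.lookup y∉ z∈ (≡.sym z≡y))))) (+-identityʳ _)
  ∑-δ {xs = y ∷ xs} (y∉ ∷ xs!) (there x∈) h≈e =
    ≈-trans (+-cong (h≈e y (All.lookup y∉ x∈)) (∑-δ xs! x∈ h≈e)) (+-identityˡ _)

  ∑-restrict : (xs : List X) {ys : List X} {g : X → Carrier} → Unique ys → (∀ {x} → x ∉ ys → g x ≈ e) →
               ∑ xs g ≈ ∑ xs (λ x → ∑ ys (λ y → when (x ≟ y) (g y)))
  ∑-restrict xs {ys} {g} ys! g≈e = ∑-cong xs (λ {x} _ → go x em)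
    where
    go : ∀ x → Dec (x ∈ ys) → g x ≈ ∑ ys (λ y → when (x ≟ y) (g y))
    go x (yes x∈) = ≈-sym (≈-trans (∑-δ ys! x∈ (λ z z≢x → when-no (x ≟ z) (λ x≡z → z≢x (≡.sym x≡z))))
                                   (when-yes (x ≟ x) refl))
    go x (no x∉)  = ≈-trans (g≈e x∉)
      (≈-sym (∑-e ys (λ {y} y∈ → when-no (x ≟ y) (λ { refl → x∉ y∈ }))))

  ∑-support : {xs ys : List X} {g : X → Carrier} → Unique xs → Unique ys →
              (∀ {x} → x ∉ xs → g x ≈ e) → (∀ {x} → x ∉ ys → g x ≈ e) → ∑ xs g ≈ ∑ ys g
  ∑-support {xs = xs} {ys} {g} xs! ys! outside-xs outside-ys = begin
    ∑ xs g                                          ≈⟨ ∑-restrict xs ys! outside-ys ⟩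
    ∑ xs (λ x → ∑ ys (λ y → when (x ≟ y) (g y)))    ≈⟨ ∑-swap xs ys ⟩
    ∑ ys (λ y → ∑ xs (λ x → when (x ≟ y) (g y)))    ≈⟨ ∑-cong ys (λ {y} _ → ∑-cong xs (λ {x} _ → flip x y)) ⟩
    ∑ ys (λ y → ∑ xs (λ x → when (y ≟ x) (g x)))    ≈⟨ ∑-restrict ys xs! outside-xs ⟨
    ∑ ys g                                          ∎
    where
    flip : ∀ x y → when (x ≟ y) (g y) ≈ when (y ≟ x) (g x)
    flip x y with x ≟ y
    ... | yes refl = ≈-sym (when-yes (x ≟ x) refl)
    ... | no x≢y   = ≈-sym (when-no (y ≟ x) (λ y≡x → x≢y (≡.sym y≡x)))

  record FinSupp (X : Set ℓ) : Set ℓ where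
    field
      weight  : X → Carrier
      support : List X
      covers  : ∀ {x} → ¬ (weight x ≈ e) → x ∈ support

  open FinSupp public

  -- The given list may repeat elements and may contain elements of weight e.
  supportSet : FinSupp X → List X
  supportSet μ = deduplicate _≟_ (support μ)

  supportSet-! : (μ : FinSupp X) → Unique (supportSet μ)
  supportSet-! μ = deduplicate-! _≟_ (support μ)

  outside : {xs : List X} {k : X → Carrier} → (∀ {x} → ¬ (k x ≈ e) → x ∈ xs) → ∀ {x} → x ∉ xs → k x ≈ e
  outside {k = k} cov {x} x∉ with em {k x ≈ e}
  ... | yes k≈e = k≈e
  ... | no k≉e  = ⊥-elim (x∉ (cov k≉e))

  outside-supportSet : (μ : FinSupp X) → ∀ {x} → x ∉ supportSet μ → weight μ x ≈ e
  outside-supportSet μ = outside (λ k≉e → ∈-deduplicate⁺ _≟_ (covers μ k≉e))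

  fibreSum : (X → Y) → FinSupp X → Y → Carrier
  fibreSum f μ y = ∑ (supportSet μ) (λ x → when (f x ≟ y) (weight μ x))

  push : (X → Y) → FinSupp X → FinSupp Y
  push f μ = record
    { weight  = fibreSum f μ
    ; support = map f (support μ)
    ; covers  = λ {y} ≉e → covered y ≉e em
    }
    where
    covered : ∀ y → ¬ (fibreSum f μ y ≈ e) → Dec (y ∈ map f (support μ)) → y ∈ map f (support μ)
    covered y ≉e (yes y∈) = y∈
    covered y ≉e (no y∉)  = ⊥-elim (≉e (∑-e (supportSet μ) vanish))
      where
      vanish : ∀ {x} → x ∈ supportSet μ → when (f x ≟ y) (weight μ x) ≈ e
      vanish {x} _ with f x ≟ y
      ... | no _     = ≈-refl
      ... | yes refl = outside (covers μ) (λ x∈ → y∉ (∈-map⁺ f x∈))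

  push-via : (f : X → Y) (μ : FinSupp X) {xs : List X} → Unique xs → (∀ {x} → x ∉ xs → weight μ x ≈ e) →
             ∀ y → weight (push f μ) y ≈ ∑ xs (λ x → when (f x ≟ y) (weight μ x))
  push-via f μ xs! out y = ∑-support (supportSet-! μ) xs!
    (λ {x} x∉ → when-e (f x ≟ y) (outside-supportSet μ x∉)) (λ {x} x∉ → when-e (f x ≟ y) (out x∉))

  push-mono : (f : X → Y) (μ ν : FinSupp X) → (∀ x → weight μ x ⊑ weight ν x) →
              ∀ y → weight (push f μ) y ⊑ weight (push f ν) y
  push-mono f μ ν μ⊑ν y =
    ⊑-trans (⊑-reflexive (push-via f μ both! (outside (λ ≉e → inBoth (∈-++⁺ˡ (covers μ ≉e)))) y))
    (⊑-trans (∑-mono both (λ x → when-mono (f x ≟ y) (μ⊑ν x)))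
    (⊑-reflexive (≈-sym (push-via f ν both! (outside (λ ≉e → inBoth (∈-++⁺ʳ (support μ) (covers ν ≉e)))) y))))
    where
    both = deduplicate _≟_ (support μ ++ support ν)
    both! = deduplicate-! _≟_ (support μ ++ support ν)
    inBoth : ∀ {x} → x ∈ support μ ++ support ν → x ∈ both
    inBoth = ∈-deduplicate⁺ _≟_

  push-family : (g : X → Y) (μ : FinSupp X) (is : List I) (h : I → X) (k : I → Carrier) →
                (∀ x → weight μ x ≈ ∑ is (λ i → when (h i ≟ x) (k i))) →
                (∀ {i} → i ∈ is → h i ∈ support μ) →
                ∀ y → weight (push g μ) y ≈ ∑ is (λ i → when (g (h i) ≟ y) (k i))
  push-family g μ is h k μ≈ h∈ y = begin
    ∑ D (λ x → when (g x ≟ y) (weight μ x))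
      ≈⟨ ∑-cong D (λ {x} _ → ≈-trans (when-cong (g x ≟ y) (μ≈ x)) (when-∑ (g x ≟ y) is)) ⟩
    ∑ D (λ x → ∑ is (λ i → when (g x ≟ y) (when (h i ≟ x) (k i))))
      ≈⟨ ∑-swap D is ⟩
    ∑ is (λ i → ∑ D (λ x → when (g x ≟ y) (when (h i ≟ x) (k i))))
      ≈⟨ ∑-cong is (λ {i} i∈ → ≈-trans
           (∑-δ (supportSet-! μ) (∈-deduplicate⁺ _≟_ (h∈ i∈))
             (λ z z≢ → when-e (g z ≟ y) (when-no (h i ≟ z) (λ eq → z≢ (≡.sym eq)))))
           (when-cong (g (h i) ≟ y) (when-yes (h i ≟ h i) refl))) ⟩
    ∑ is (λ i → when (g (h i) ≟ y) (k i))
      ∎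
    where D = supportSet μ

  push-id : (μ : FinSupp X) → ∀ x → weight (push idf μ) x ≈ weight μ x
  push-id μ x with em {x ∈ supportSet μ}
  ... | yes x∈ = ≈-trans (∑-δ (supportSet-! μ) x∈ (λ z z≢x → when-no (z ≟ x) z≢x)) (when-yes (x ≟ x) refl)
  ... | no x∉  = ≈-trans (∑-e (supportSet μ) (λ {z} z∈ → when-no (z ≟ x) (λ { refl → x∉ z∈ })))
                         (≈-sym (outside-supportSet μ x∉))

  push-∘ : (g : Y → Z) (f : X → Y) (μ : FinSupp X) →
           ∀ z → weight (push (g ∘′ f) μ) z ≈ weight (push g (push f μ)) z
  push-∘ g f μ z = ≈-sym
    (push-family g (push f μ) (supportSet μ) f (weight μ) (λ _ → ≈-refl)
      (λ x∈ → ∈-map⁺ f (∈-deduplicate⁻ _≟_ (support μ) x∈)) z)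

  record PointedCoalgebra : Set (lsuc ℓ) where
    field
      State : Set ℓ
      step  : State → FinSupp (A × State)
      point : State

  open PointedCoalgebra public

  record LaxHom (X Y : PointedCoalgebra) : Set ℓ where
    field
      fun       : State X → State Y
      fun-point : fun (point X) ≡ point Y
      lax       : ∀ x ay → weight (push (map₂ fun) (step X x)) ay ⊑ weight (step Y (fun x)) ay

  open LaxHom public

  IsProper : ∀ {X Y} → LaxHom X Y → Set ℓ
  IsProper {X} {Y} f = ∀ x ay → weight (push (map₂ (fun f)) (step X x)) ay ≈ weight (step Y (fun f x)) ay

  idLax : ∀ {X} → LaxHom X X
  idLax {X} = record
    { fun = idf ; fun-point = refl ; lax = λ x ay → ⊑-reflexive (push-id (step X x) ay) }

  infixr 9 _∘ᴸ_
  _∘ᴸ_ : ∀ {X Y Z} → LaxHom Y Z → LaxHom X Y → LaxHom X Z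
  _∘ᴸ_ {X} {Y} {Z} g f = record
    { fun       = fun g ∘′ fun f
    ; fun-point = ≡.trans (≡.cong (fun g) (fun-point f)) (fun-point g)
    ; lax       = λ x az →
        ⊑-trans (⊑-reflexive (push-∘ (map₂ (fun g)) (map₂ (fun f)) (step X x) az))
        (⊑-trans (push-mono (map₂ (fun g)) (push (map₂ (fun f)) (step X x)) (step Y (fun f x)) (lax f x) az)
                 (lax g (fun f x) az))
    }

  LCoalg : CategoryOn PointedCoalgebra ℓ ℓ
  LCoalg = record
    { _⇒_           = LaxHom
    ; _≋_           = λ f g → ∀ x → fun f x ≡ fun g x
    ; id            = idLax
    ; _∘_           = _∘ᴸ_
    ; ≋-equivalence = record
        { refl  = λ _ → refl
        ; sym   = λ f≋g x → ≡.sym (f≋g x)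
        ; trans = λ f≋g g≋h x → ≡.trans (f≋g x) (g≋h x) }
    ; ∘-assoc       = λ _ → refl
    ; ∘-identityˡ   = λ _ → refl
    ; ∘-identityʳ   = λ _ → refl
    ; ∘-cong        = λ {_} {_} {_} {f} {_} {_} {g′} f≋f′ g≋g′ x →
        ≡.trans (≡.cong (fun f) (g≋g′ x)) (f≋f′ (fun g′ x))
    }

  CoalgebraicallyBisimilar : PointedCoalgebra → PointedCoalgebra → Set (lsuc ℓ)
  CoalgebraicallyBisimilar X Y =
    Σ[ Z ∈ PointedCoalgebra ] (Σ[ f ∈ LaxHom Z X ] IsProper f) × (Σ[ g ∈ LaxHom Z Y ] IsProper g)

  -- (source , (letter , target) , weight)
  Transition : Set ℓ → Set ℓ
  Transition X = X × (A × X) × Carrier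

  ⟦_⟧ : List (X × Carrier) → FinSupp X
  ⟦ ps ⟧ = record
    { weight  = λ x → ∑ ps (λ (y , k) → when (y ≟ x) k)
    ; support = map proj₁ ps
    ; covers  = λ {x} ≉e → covered x ≉e em
    }
    where
    covered : ∀ x → ¬ (∑ ps (λ (y , k) → when (y ≟ x) k) ≈ e) → Dec (x ∈ map proj₁ ps) → x ∈ map proj₁ ps
    covered x ≉e (yes x∈) = x∈
    covered x ≉e (no x∉)  =
      ⊥-elim (≉e (∑-e ps (λ {(y , k)} q∈ → when-no (y ≟ x) (λ { refl → x∉ (∈-map⁺ proj₁ q∈) }))))

  -- The weight from x to (a , y) is the sum of the weights of all listed
  -- transitions from x to y with letter a; it is e if there is none.
  generate : List (Transition X) → X → FinSupp (A × X)
  generate ts x = ⟦ map proj₂ (filter (λ t → proj₁ t ≟ x) ts) ⟧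

  ∑-outgoing : (ts : List (Transition X)) (x : X) {g : (A × X) × Carrier → Carrier} →
               ∑ (map proj₂ (filter (λ t → proj₁ t ≟ x) ts)) g ≈ ∑ ts (λ (s , r) → when (s ≟ x) (g r))
  ∑-outgoing []       x = ≈-refl
  ∑-outgoing (t ∷ ts) x with does (proj₁ t ≟ x)
  ... | true  = +-congˡ (∑-outgoing ts x)
  ... | false = ≈-trans (∑-outgoing ts x) (≈-sym (+-identityˡ _))

  generate-weight : (ts : List (Transition X)) (x : X) (ay : A × X) →
                    weight (generate ts x) ay ≈ ∑ ts (λ (s , bz , k) → when (s ≟ x) (when (bz ≟ ay) k))
  generate-weight ts x ay = ∑-outgoing ts x

  generate-push : (f : A × X → Y) (ts : List (Transition X)) (x : X) (y : Y) →
                  weight (push f (generate ts x)) y ≈ ∑ ts (λ (s , bz , k) → when (s ≟ x) (when (f bz ≟ y) k))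
  generate-push f ts x y = ≈-trans
    (push-family f (generate ts x) (map proj₂ (filter (λ t → proj₁ t ≟ x) ts)) proj₁ proj₂
      (λ _ → ≈-refl) (∈-map⁺ proj₁) y)
    (∑-outgoing ts x)

  NonUnit : Set ℓ
  NonUnit = Σ[ k ∈ Carrier ] ¬ (k ≈ e)

  Word : Set ℓ
  Word = List (A × NonUnit)

  ∣_∣ : List⁺ NonUnit → ℕ
  ∣ l ∣ = length (toList l)

  letterAt : (w : Word) → Fin (length w) → A
  letterAt w i = proj₁ (lookup w i)

  weightAt : (w : Word) → Fin (length w) → Carrier
  weightAt w i = proj₁ (proj₂ (lookup w i))

  leafWeight : (l : List⁺ NonUnit) → Fin ∣ l ∣ → Carrier
  leafWeight l j = proj₁ (lookup (toList l) j)

  data Shape : Set ℓ where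
    path : Word → Shape
    fan  : Word → A → List⁺ NonUnit → Shape

  -- spine i is the state i ∈ {0 , … , n}; leaf j is the state (n + 1 , j + 1).
  data TreeState (n m : ℕ) : Set ℓ where
    spine : Fin (ℕ.suc n) → TreeState n m
    leaf  : Fin m → TreeState n m

  spineTransition : (w : Word) {m : ℕ} → Fin (length w) → Transition (TreeState (length w) m)
  spineTransition w i = spine (inject₁ i) , (letterAt w i , spine (Fin.suc i)) , weightAt w i

  leafTransition : (n : ℕ) (b : A) (l : List⁺ NonUnit) → Fin ∣ l ∣ → Transition (TreeState n ∣ l ∣)
  leafTransition n b l j = spine (fromℕ n) , (b , leaf j) , leafWeight l j

  spineTransitions : (w : Word) {m : ℕ} → List (Transition (TreeState (length w) m))
  spineTransitions w = map (spineTransition w) (allFin (length w))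

  leafTransitions : (n : ℕ) (b : A) (l : List⁺ NonUnit) → List (Transition (TreeState n ∣ l ∣))
  leafTransitions n b l = map (leafTransition n b l) (allFin ∣ l ∣)

  J : Shape → PointedCoalgebra
  J (path w) = record
    { State = TreeState (length w) 0
    ; step  = generate (spineTransitions w)
    ; point = spine Fin.zero
    }
  J (fan w b l) = record
    { State = TreeState (length w) ∣ l ∣
    ; step  = generate (spineTransitions w ++ leafTransitions (length w) b l)
    ; point = spine Fin.zero
    }

  IsReachableState : (X : PointedCoalgebra) → State X → Set ℓ
  IsReachableState X p = Σ[ w ∈ Word ] Σ[ x ∈ LaxHom (J (path w)) X ] fun x (spine (fromℕ (length w))) ≡ p

  IsReachable : PointedCoalgebra → Set ℓ
  IsReachable X = ∀ p → IsReachableState X p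

  infix 4 _⇒ᴱ_ _⇒ˢ_
  data _⇒ᴱ_ : Shape → Shape → Set ℓ where
    idᴱ    : ∀ {v} → v ⇒ᴱ v
    branch : ∀ {w b l} → path w ⇒ᴱ fan w b l

  _∘ᴱ_ : ∀ {u v w} → v ⇒ᴱ w → u ⇒ᴱ v → u ⇒ᴱ w
  idᴱ    ∘ᴱ g   = g
  branch ∘ᴱ idᴱ = branch

  E-K : CategoryOn Shape ℓ ℓ
  E-K = record
    { _⇒_           = _⇒ᴱ_
    ; _≋_           = _≡_
    ; id            = idᴱ
    ; _∘_           = _∘ᴱ_
    ; ≋-equivalence = ≡.isEquivalence
    ; ∘-assoc       = λ {_} {_} {_} {_} {f} {g} {h} → assoc f g h
    ; ∘-identityˡ   = refl
    ; ∘-identityʳ   = λ {_} {_} {f} → identityʳ f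
    ; ∘-cong        = ≡.cong₂ _∘ᴱ_
    }
    where
    assoc : ∀ {t u v w} (f : v ⇒ᴱ w) (g : u ⇒ᴱ v) (h : t ⇒ᴱ u) → (f ∘ᴱ g) ∘ᴱ h ≡ f ∘ᴱ (g ∘ᴱ h)
    assoc idᴱ    g   h   = refl
    assoc branch idᴱ idᴱ = refl
    identityʳ : ∀ {v w} (f : v ⇒ᴱ w) → f ∘ᴱ idᴱ ≡ f
    identityʳ idᴱ    = refl
    identityʳ branch = refl

  include : ∀ {n m} → TreeState n 0 → TreeState n m
  include (spine i) = spine i

  include-injective : ∀ {n m} {p q : TreeState n 0} → include {m = m} p ≡ include q → p ≡ q
  include-injective {p = spine _} {spine _} refl = refl

  -- J_E takes values in LCoalg only if the inclusions of states are lax. At the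
  -- state n this says e ⊑ lⱼ for all j, so it holds if K is positively ordered,
  -- and it fails for every other K, unless A is empty.
  InclusionsAreLax : Set ℓ
  InclusionsAreLax = ∀ w b l p ay →
    weight (push (map₂ include) (step (J (path w)) p)) ay ⊑ weight (step (J (fan w b l)) (include p)) ay

  positive⇒inclusionsAreLax : PositivelyOrdered K → InclusionsAreLax
  positive⇒inclusionsAreLax pos w b l p ay =
    ⊑-trans (⊑-reflexive left) (⊑-trans
    (⊑-trans (⊑-reflexive (≈-sym (+-identityʳ _))) (+-mono (⊑-reflexive middle) (pos _)))
    (⊑-reflexive (≈-sym right)))
    where
    n = length w
    source : Fin n → Carrier
    source i = when (spine (inject₁ i) ≟ p) (when ((letterAt w i , spine (Fin.suc i)) ≟ ay) (weightAt w i))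
    target : Transition (TreeState n ∣ l ∣) → Carrier
    target (s , bz , k) = when (s ≟ include p) (when (bz ≟ ay) k)
    left : weight (push (map₂ include) (step (J (path w)) p)) ay ≈ ∑ (allFin n) source
    left = ≈-trans (generate-push (map₂ include) (spineTransitions w) p ay) (∑-map (spineTransition w) (allFin n))
    middle : ∑ (allFin n) source ≈ ∑ (spineTransitions w) target
    middle = ≈-sym (≈-trans (∑-map (spineTransition w) (allFin n)) (∑-cong (allFin n) (λ {i} _ →
      when-⇔ (spine (inject₁ i) ≟ include p) (spine (inject₁ i) ≟ p) include-injective (≡.cong include) ≈-refl)))
    right : weight (step (J (fan w b l)) (include p)) ay
            ≈ ∑ (spineTransitions w) target + ∑ (leafTransitions n b l) target
    right = ≈-trans (generate-weight (spineTransitions w ++ leafTransitions n b l) (include p) ay)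
                    (∑-++ (spineTransitions w) (leafTransitions n b l))

  JE-map : InclusionsAreLax → ∀ {v w} → v ⇒ᴱ w → LaxHom (J v) (J w)
  JE-map incl idᴱ                  = idLax
  JE-map incl (branch {w} {b} {l}) =
    record { fun = include ; fun-point = refl ; lax = incl w b l }

  JE-K : InclusionsAreLax → FunctorOver E-K LCoalg J
  JE-K incl = record
    { F₁     = JE-map incl
    ; F-cong = λ { refl _ → refl }
    ; F-id   = λ _ → refl
    ; F-∘    = λ {_} {_} {_} {f} {g} → preserves-∘ f g
    }
    where
    preserves-∘ : ∀ {u v w} (f : v ⇒ᴱ w) (g : u ⇒ᴱ v) → ∀ p →
                  fun (JE-map incl (f ∘ᴱ g)) p ≡ fun (JE-map incl f) (fun (JE-map incl g) p)
    preserves-∘ idᴱ    g   p = refl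
    preserves-∘ branch idᴱ p = refl

  record Merging (l′ l : List⁺ NonUnit) : Set ℓ where
    field
      mergeTo    : Fin ∣ l′ ∣ → Fin ∣ l ∣
      monotone   : ∀ {i j} → i Fin.≤ j → mergeTo i Fin.≤ mergeTo j
      surjective : Surjective _≡_ _≡_ mergeTo
      weights    : ∀ i → leafWeight l i ≈ ∑ (allFin ∣ l′ ∣) (λ j → when (mergeTo j Fin.≟ i) (leafWeight l′ j))

  open Merging public

  ∑-merge : ∀ {m m′} (s : Fin m′ → Fin m) (k : Fin m′ → Carrier) (l : Fin m → Carrier) →
            (∀ i → l i ≈ ∑ (allFin m′) (λ j → when (s j Fin.≟ i) (k j))) →
            {P : Fin m → Set p} (d : ∀ i → Dec (P i)) →
            ∑ (allFin m) (λ i → when (d i) (l i)) ≈ ∑ (allFin m′) (λ j → when (d (s j)) (k j))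
  ∑-merge {m = m} {m′} s k l l≈ d = begin
    ∑ (allFin m) (λ i → when (d i) (l i))
      ≈⟨ ∑-cong (allFin m) (λ {i} _ → ≈-trans (when-cong (d i) (l≈ i)) (when-∑ (d i) (allFin m′))) ⟩
    ∑ (allFin m) (λ i → ∑ (allFin m′) (λ j → when (d i) (when (s j Fin.≟ i) (k j))))
      ≈⟨ ∑-swap (allFin m) (allFin m′) ⟩
    ∑ (allFin m′) (λ j → ∑ (allFin m) (λ i → when (d i) (when (s j Fin.≟ i) (k j))))
      ≈⟨ ∑-cong (allFin m′) (λ {j} _ → ≈-trans
           (∑-δ (Unique.allFin⁺ m) (∈-allFin (s j))
             (λ z z≢ → when-e (d z) (when-no (s j Fin.≟ z) (λ eq → z≢ (≡.sym eq)))))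
           (when-cong (d (s j)) (when-yes (s j Fin.≟ s j) refl))) ⟩
    ∑ (allFin m′) (λ j → when (d (s j)) (k j))
      ∎

  data _⇒ˢ_ : Shape → Shape → Set ℓ where
    stay  : ∀ {w} → path w ⇒ˢ path w
    merge : ∀ {w b l′ l} → Merging l′ l → fan w b l′ ⇒ˢ fan w b l

  mergeStates : ∀ {n m m′} → (Fin m′ → Fin m) → TreeState n m′ → TreeState n m
  mergeStates s (spine i) = spine i
  mergeStates s (leaf j)  = leaf (s j)

  onStates : ∀ {v w} → v ⇒ˢ w → State (J v) → State (J w)
  onStates stay      = idf
  onStates (merge s) = mergeStates (mergeTo s)

  idˢ : ∀ {v} → v ⇒ˢ v
  idˢ {path w}    = stay
  idˢ {fan w b l} = merge (record
    { mergeTo    = idf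
    ; monotone   = idf
    ; surjective = λ i → i , idf
    ; weights    = λ i → ≈-sym (≈-trans
        (∑-δ (Unique.allFin⁺ ∣ l ∣) (∈-allFin i) (λ z z≢i → when-no (z Fin.≟ i) z≢i))
        (when-yes (i Fin.≟ i) refl))
    })

  _∘ˢ_ : ∀ {u v w} → v ⇒ˢ w → u ⇒ˢ v → u ⇒ˢ w
  stay    ∘ˢ stay    = stay
  merge s ∘ˢ merge t = merge (record
    { mergeTo    = mergeTo s ∘′ mergeTo t
    ; monotone   = λ i≤j → monotone s (monotone t i≤j)
    ; surjective = Composition.surjective _≡_ _≡_ _≡_ (surjective t) (surjective s)
    ; weights    = λ i → ≈-trans (weights s i)
        (∑-merge (mergeTo t) _ _ (weights t) (λ j → mergeTo s j Fin.≟ i))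
    })

  onStates-id : ∀ v p → onStates (idˢ {v}) p ≡ p
  onStates-id (path _)    _         = refl
  onStates-id (fan _ _ _) (spine _) = refl
  onStates-id (fan _ _ _) (leaf _)  = refl

  onStates-∘ : ∀ {u v w} (s : v ⇒ˢ w) (t : u ⇒ˢ v) p → onStates (s ∘ˢ t) p ≡ onStates s (onStates t p)
  onStates-∘ stay      stay      _         = refl
  onStates-∘ (merge _) (merge _) (spine _) = refl
  onStates-∘ (merge _) (merge _) (leaf _)  = refl

  -- Two morphisms are equal iff their surjections are pointwise equal, which
  -- is to say that they act equally on states.
  S-K : CategoryOn Shape ℓ ℓ
  S-K = record
    { _⇒_           = _⇒ˢ_
    ; _≋_           = λ s t → ∀ p → onStates s p ≡ onStates t p
    ; id            = idˢ
    ; _∘_           = _∘ˢ_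
    ; ≋-equivalence = record
        { refl  = λ _ → refl
        ; sym   = λ s≋t p → ≡.sym (s≋t p)
        ; trans = λ s≋t t≋r p → ≡.trans (s≋t p) (t≋r p) }
    ; ∘-assoc       = λ {_} {_} {_} {_} {s} {t} {r} p →
        ≡.trans (onStates-∘ (s ∘ˢ t) r p) (≡.trans (onStates-∘ s t (onStates r p))
        (≡.sym (≡.trans (onStates-∘ s (t ∘ˢ r) p) (≡.cong (onStates s) (onStates-∘ t r p)))))
    ; ∘-identityˡ   = λ {_} {v} {s} p → ≡.trans (onStates-∘ idˢ s p) (onStates-id v (onStates s p))
    ; ∘-identityʳ   = λ {v} {_} {s} p → ≡.trans (onStates-∘ s idˢ p) (≡.cong (onStates s) (onStates-id v p))
    ; ∘-cong        = λ {_} {_} {_} {s} {s′} {t} {t′} s≋s′ t≋t′ p →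
        ≡.trans (onStates-∘ s t p) (≡.trans (≡.cong (onStates s) (t≋t′ p))
        (≡.trans (s≋s′ (onStates t′ p)) (≡.sym (onStates-∘ s′ t′ p))))
    }

  spine≡mergeStates : ∀ {n m m′} {s : Fin m′ → Fin m} {i : Fin (ℕ.suc n)} {p} →
                      spine i ≡ mergeStates s p → spine i ≡ p
  spine≡mergeStates {p = spine _} refl = refl

  spine≡mergeStates⁻ : ∀ {n m m′} {s : Fin m′ → Fin m} {i : Fin (ℕ.suc n)} {p} →
                       spine i ≡ p → spine i ≡ mergeStates s p
  spine≡mergeStates⁻ refl = refl

  merging : ∀ w b {l′ l} → Merging l′ l → LaxHom (J (fan w b l′)) (J (fan w b l))
  merging w b {l′} {l} s = record { fun = act ; fun-point = refl ; lax = λ p ay → ⊑-reflexive (isProper p ay) }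
    where
    n = length w
    act : TreeState n ∣ l′ ∣ → TreeState n ∣ l ∣
    act = mergeStates (mergeTo s)
    isProper : ∀ p ay → weight (push (map₂ act) (step (J (fan w b l′)) p)) ay ≈ weight (step (J (fan w b l)) (act p)) ay
    isProper p ay = begin
      weight (push (map₂ act) (step (J (fan w b l′)) p)) ay
        ≈⟨ generate-push (map₂ act) (spineTransitions w ++ leafTransitions n b l′) p ay ⟩
      ∑ (spineTransitions w ++ leafTransitions n b l′) source
        ≈⟨ ∑-++ (spineTransitions w) (leafTransitions n b l′) ⟩
      ∑ (spineTransitions w) source + ∑ (leafTransitions n b l′) source
        ≈⟨ +-cong (∑-map (spineTransition w) (allFin n)) (∑-map (leafTransition n b l′) (allFin ∣ l′ ∣)) ⟩
      ∑ (allFin n) (λ i → source (spineTransition w i)) + ∑ (allFin ∣ l′ ∣) (λ j → source (leafTransition n b l′ j))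
        ≈⟨ +-cong (∑-cong (allFin n) (λ {i} _ → sameSource (inject₁ i))) leaves ⟩
      ∑ (allFin n) (λ i → target (spineTransition w i)) + ∑ (allFin ∣ l ∣) (λ j → target (leafTransition n b l j))
        ≈⟨ +-cong (∑-map (spineTransition w) (allFin n)) (∑-map (leafTransition n b l) (allFin ∣ l ∣)) ⟨
      ∑ (spineTransitions w) target + ∑ (leafTransitions n b l) target
        ≈⟨ ∑-++ (spineTransitions w) (leafTransitions n b l) ⟨
      ∑ (spineTransitions w ++ leafTransitions n b l) target
        ≈⟨ generate-weight (spineTransitions w ++ leafTransitions n b l) (act p) ay ⟨
      weight (step (J (fan w b l)) (act p)) ay
        ∎
      where
      source : Transition (TreeState n ∣ l′ ∣) → Carrier
      source (q , bz , k) = when (q ≟ p) (when (map₂ act bz ≟ ay) k)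
      target : Transition (TreeState n ∣ l ∣) → Carrier
      target (q , bz , k) = when (q ≟ act p) (when (bz ≟ ay) k)
      sameSource : ∀ i {k} → when (spine i ≟ p) k ≈ when (spine i ≟ act p) k
      sameSource i = when-⇔ (spine i ≟ p) (spine i ≟ act p) spine≡mergeStates⁻ spine≡mergeStates ≈-refl
      leaves : ∑ (allFin ∣ l′ ∣) (λ j → source (leafTransition n b l′ j))
               ≈ ∑ (allFin ∣ l ∣) (λ j → target (leafTransition n b l j))
      leaves = begin
        ∑ (allFin ∣ l′ ∣) (λ j → when (spine (fromℕ n) ≟ p) (when ((b , leaf (mergeTo s j)) ≟ ay) (leafWeight l′ j)))
          ≈⟨ when-∑ (spine (fromℕ n) ≟ p) (allFin ∣ l′ ∣) ⟨
        when (spine (fromℕ n) ≟ p) (∑ (allFin ∣ l′ ∣) (λ j → when ((b , leaf (mergeTo s j)) ≟ ay) (leafWeight l′ j)))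
          ≈⟨ when-cong (spine (fromℕ n) ≟ p)
               (∑-merge (mergeTo s) (leafWeight l′) (leafWeight l) (weights s) (λ i → (b , leaf i) ≟ ay)) ⟨
        when (spine (fromℕ n) ≟ p) (∑ (allFin ∣ l ∣) (λ i → when ((b , leaf i) ≟ ay) (leafWeight l i)))
          ≈⟨ sameSource (fromℕ n) ⟩
        when (spine (fromℕ n) ≟ act p) (∑ (allFin ∣ l ∣) (λ i → when ((b , leaf i) ≟ ay) (leafWeight l i)))
          ≈⟨ when-∑ (spine (fromℕ n) ≟ act p) (allFin ∣ l ∣) ⟩
        ∑ (allFin ∣ l ∣) (λ i → when (spine (fromℕ n) ≟ act p) (when ((b , leaf i) ≟ ay) (leafWeight l i)))
          ∎

  JS-map : ∀ {v w} → v ⇒ˢ w → LaxHom (J v) (J w)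
  JS-map stay              = idLax
  JS-map (merge {w} {b} s) = merging w b s

  JS-K : FunctorOver S-K LCoalg J
  JS-K = record
    { F₁     = JS-map
    ; F-cong = λ {_} {_} {s} {t} s≋t p → ≡.trans (acts s p) (≡.trans (s≋t p) (≡.sym (acts t p)))
    ; F-id   = λ {v} p → ≡.trans (acts (idˢ {v}) p) (onStates-id v p)
    ; F-∘    = λ {_} {_} {_} {s} {t} p → ≡.trans (acts (s ∘ˢ t) p) (≡.trans (onStates-∘ s t p)
        (≡.sym (≡.trans (acts s _) (≡.cong (onStates s) (acts t p)))))
    }
    where
    acts : ∀ {v w} (s : v ⇒ˢ w) p → fun (JS-map s) p ≡ onStates s p
    acts stay      _ = refl
    acts (merge _) _ = refl

  openMapData : InclusionsAreLax → OpenMapData LCoalg ℓ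
  openMapData incl = record
    { V = Shape ; J = J ; E = E-K ; S = S-K ; JE = JE-K incl ; JS = JS-K }

-- If f is open at a reachable state p and k is the weight from f p to (b , y),
-- then the run to p, followed by one b-transition of weight k to y, lifts to X
-- along a merging; the weights of the lifted leaves add up to k, so that k is
-- below the pushed weight at p, and laxness of f gives the other inequality.
--
-- If f is proper, laxness of y : J (fan w b l) → Y at the branching state n says
-- that, over each z, the leaves sent to z weigh at most the fibre of f over z.
-- Rearranging over each z splits the leaves along the transitions of X, and
-- the non-unit shares, in order of their leaf, form the word that lifts y.
--
-- An open map out of Z need not be proper at unreachable states; cutting Z down
-- to its reachable part turns a span of open maps into a span of proper ones.
module Submission where

open import Axiom.ExcludedMiddle using (ExcludedMiddle)
open import Data.Bool.Properties using (T-irrelevant)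
open import Data.Empty using (⊥-elim)
open import Data.Fin.Base as Fin using (Fin; inject₁; fromℕ)
import Data.Fin.Properties as Fin
open import Data.Fin.Relation.Unary.Top using (view; ‵fromℕ; ‵inject₁)
open import Data.List.Base using (List; []; _∷_; _++_; map; concatMap; length; lookup; tabulate; allFin)
open import Data.List.Membership.Propositional using (_∈_; find; lose)
open import Data.List.Membership.Propositional.Properties using (∈-map⁺; ∈-map⁻; ∈-allFin; ∈-concatMap⁺; ∈-concatMap⁻; ∈-deduplicate⁺)
open import Data.List.NonEmpty.Base using (List⁺; _∷_; toList)
open import Data.List.Properties using (map-tabulate; tabulate-lookup)
open import Data.List.Relation.Unary.All as All using (All)
import Data.List.Relation.Unary.All.Properties as All
open import Data.List.Relation.Unary.AllPairs as AllPairs using (AllPairs; []; _∷_)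
import Data.List.Relation.Unary.AllPairs.Properties as AllPairs
open import Data.List.Relation.Unary.Any using (here; there)
import Data.List.Relation.Unary.Unique.Propositional.Properties as Unique
open import Data.Nat.Base using (ℕ; zero; suc; z≤n; s≤s; _≥_)
import Data.Nat.Properties as ℕ
open import Data.Product.Base using (Σ-syntax; _×_; _,_; proj₁; proj₂; map₂)
open import Data.Unit.Base using (tt)
open import Function.Base using (_∘′_) renaming (id to idf)
open import Function.Bundles using (_⇔_; mk⇔)
open import Level using (Level)
open import Relation.Binary.Construct.Closure.ReflexiveTransitive using (Star; ε; _◅_; _◅◅_)
open import Relation.Binary.Core using (Rel)
open import Relation.Binary.Definitions using (Reflexive)
open import Relation.Binary.PropositionalEquality as ≡ using (_≡_; _≢_; refl)
open import Relation.Nullary using (¬_; Dec; yes; no)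
open import Relation.Nullary.Decidable using (True; toWitness; fromWitness)
open import Defs

private
  variable
    a b p r : Level
    I : Set a
    T : Set b

-- Positions in mapped lists and the order of their sources.

-- Recursion on the list avoids transporting positions along the merely propositional equality of
-- the lengths of `map f xs` and `xs`.
origin : (f : I → T) (xs : List I) → Fin (length (map f xs)) → I
origin f (x ∷ xs) Fin.zero    = x
origin f (x ∷ xs) (Fin.suc i) = origin f xs i

lookup-map-origin : (f : I → T) (xs : List I) → ∀ i → lookup (map f xs) i ≡ f (origin f xs i)
lookup-map-origin f (x ∷ xs) Fin.zero    = refl
lookup-map-origin f (x ∷ xs) (Fin.suc i) = lookup-map-origin f xs i

origin-∈ : (f : I → T) (xs : List I) → ∀ i → origin f xs i ∈ xs
origin-∈ f (x ∷ xs) Fin.zero    = here refl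
origin-∈ f (x ∷ xs) (Fin.suc i) = there (origin-∈ f xs i)

tabulate-origin : (f : I → T) (xs : List I) → tabulate (origin f xs) ≡ xs
tabulate-origin f []       = refl
tabulate-origin f (x ∷ xs) = ≡.cong (x ∷_) (tabulate-origin f xs)

origin-monotone : {R : Rel I r} → Reflexive R → (f : I → T) (xs : List I) → AllPairs R xs →
                  ∀ {i j} → i Fin.≤ j → R (origin f xs i) (origin f xs j)
origin-monotone R-refl f (x ∷ xs) _            {Fin.zero}  {Fin.zero}  _         = R-refl
origin-monotone R-refl f (x ∷ xs) (Rx ∷ _)     {Fin.zero}  {Fin.suc j} _         = All.lookup Rx (origin-∈ f xs j)
origin-monotone R-refl f (x ∷ xs) (_ ∷ sorted) {Fin.suc i} {Fin.suc j} (s≤s i≤j) = origin-monotone R-refl f xs sorted i≤j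

allPairs-of-all : {P : I → Set p} {R : Rel I r} → (∀ {x y} → P x → P y → R x y) →
                  ∀ {xs} → All P xs → AllPairs R xs
allPairs-of-all P⇒R All.[]         = []
allPairs-of-all P⇒R (px All.∷ pxs) = All.map (P⇒R px) pxs ∷ allPairs-of-all P⇒R pxs

-- Enumerates `True d`, which has at most one element; the supports of the reachable part are
-- assembled from these lists.
decidedBy : {P : Set p} (d : Dec P) → List (True d)
decidedBy (yes _) = tt ∷ []
decidedBy (no _)  = []

∈-decidedBy : {P : Set p} (d : Dec P) (t : True d) → t ∈ decidedBy d
∈-decidedBy (yes _) tt = here refl

module _ {ℓ : Level} (em : ExcludedMiddle ℓ) (A : Set ℓ) (K : OrderedCommutativeMonoid ℓ) where
  open OrderedCommutativeMonoid K
  open Theory em A K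
  open import Algebra.Properties.CommutativeMonoid.Sum commutativeMonoid using (sum)
  open import Relation.Binary.Reasoning.PartialOrder poset

  -- Finite sums over positions, lists and concatenations.

  ∑-tabulate : ∀ {n} (f : Fin n → I) {g : I → Carrier} → ∑ (tabulate f) g ≈ ∑ (allFin n) (λ i → g (f i))
  ∑-tabulate {n = n} f {g} = begin-equality
    ∑ (tabulate f) g              ≡⟨ ≡.cong (λ xs → ∑ xs g) (map-tabulate idf f) ⟨
    ∑ (map f (allFin n)) g        ≈⟨ ∑-map f (allFin n) ⟩
    ∑ (allFin n) (λ i → g (f i))  ∎

  ∑-lookup : (xs : List I) {g : I → Carrier} → ∑ (allFin (length xs)) (λ i → g (lookup xs i)) ≈ ∑ xs g
  ∑-lookup xs {g} = ≈-trans (≈-sym (∑-tabulate (lookup xs)))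
                            (≈-reflexive (≡.cong (λ ys → ∑ ys g) (tabulate-lookup xs)))

  ∑-origin : (f : I → T) (xs : List I) {g : I → Carrier} →
             ∑ (allFin (length (map f xs))) (λ i → g (origin f xs i)) ≈ ∑ xs g
  ∑-origin f xs {g} = ≈-trans (≈-sym (∑-tabulate (origin f xs)))
                              (≈-reflexive (≡.cong (λ ys → ∑ ys g) (tabulate-origin f xs)))

  sum≈∑ : ∀ n (t : Fin n → Carrier) → sum t ≈ ∑ (allFin n) t
  sum≈∑ zero    t = ≈-refl
  sum≈∑ (suc n) t = +-congˡ (≈-trans (sum≈∑ n (t ∘′ Fin.suc)) (≈-sym (∑-tabulate Fin.suc {t})))

  ∑-concatMap : (F : I → List T) (xs : List I) {g : T → Carrier} →
                ∑ (concatMap F xs) g ≈ ∑ xs (λ x → ∑ (F x) g)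
  ∑-concatMap F []       = ≈-refl
  ∑-concatMap F (x ∷ xs) = ≈-trans (∑-++ (F x) (concatMap F xs)) (+-congˡ (∑-concatMap F xs))

  -- Words carry non-unit weights only, so a share equal to `e` has to disappear. As a list of
  -- length at most one it does so without changing any sum.
  nonUnit : ∀ {k} → Dec (k ≈ e) → List NonUnit
  nonUnit     (yes _)  = []
  nonUnit {k} (no k≉e) = (k , k≉e) ∷ []

  ∑-nonUnit : ∀ {k} (d : Dec (k ≈ e)) → ∑ (nonUnit d) proj₁ ≈ k
  ∑-nonUnit (yes k≈e) = ≈-sym k≈e
  ∑-nonUnit (no _)    = +-identityʳ _

  ∈-nonUnit : ∀ {k κ} (d : Dec (k ≈ e)) → κ ∈ nonUnit d → ¬ (k ≈ e)
  ∈-nonUnit (no k≉e) _ = k≉e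

  -- Rearrangement in positively ordered monoids.

  module _ (pos : PositivelyOrdered K) where

    summand-⊑ : {xs : List I} {x : I} {g : I → Carrier} → x ∈ xs → g x ⊑ ∑ xs g
    summand-⊑ {xs = y ∷ xs} {g = g} (here refl) = begin
      g y            ≈⟨ +-identityʳ _ ⟨
      g y + e        ≤⟨ +-mono ⊑-refl (pos _) ⟩
      g y + ∑ xs g   ∎
    summand-⊑ {xs = y ∷ xs} {x} {g} (there x∈) = begin
      g x            ≈⟨ +-identityˡ _ ⟨
      e + g x        ≤⟨ +-mono (pos _) (summand-⊑ x∈) ⟩
      g y + ∑ xs g   ∎

    ⊑e⇒≈e : ∀ {k} → k ⊑ e → k ≈ e
    ⊑e⇒≈e k⊑e = ⊑-antisym k⊑e (pos _)

    when-⊑ : {P : Set p} (d : Dec P) {k l : Carrier} → (P → k ⊑ l) → when d k ⊑ l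
    when-⊑ (yes p) k⊑l = k⊑l p
    when-⊑ (no _)  _   = pos _

    module _ (rearrangement : IsRearrangementMonoid K) where

      rearrange : ∀ {m n} (x : Fin m → Carrier) (y : Fin n → Carrier) → m ≥ 1 →
                  ∑ (allFin m) x ⊑ ∑ (allFin n) y →
                  Σ[ u ∈ (Fin m → Fin n → Carrier) ]
                    (∀ j → ∑ (allFin m) (λ i → u i j) ⊑ y j) × (∀ i → ∑ (allFin n) (u i) ≈ x i)
      -- The axiom excludes an empty right-hand side, which occurs here when the support is empty.
      -- Each `x i` is then below `e`, hence equal to it, and so agrees with its empty row.
      rearrange {n = zero} x y _ x⊑y =
        (λ _ ()) , (λ ()) , λ i → ≈-sym (⊑e⇒≈e (⊑-trans (summand-⊑ (∈-allFin i)) x⊑y))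
      rearrange {m} {n@(suc _)} x y m≥1 x⊑y
        with u , columns , rows ← rearrangement m n m≥1 (s≤s z≤n) x y
               (⊑-trans (⊑-reflexive (sum≈∑ m x)) (⊑-trans x⊑y (⊑-reflexive (≈-sym (sum≈∑ n y)))))
        = u , (λ j → ⊑-trans (⊑-reflexive (≈-sym (sum≈∑ m _))) (columns j))
            , (λ i → ≈-trans (≈-sym (sum≈∑ n (u i))) (rows i))

      -- Rearranging separately over each z and keeping from the z-th family
      -- only the rows i with g i ≡ z gives a single family that respects fibres.
      rearrangeOver : ∀ {m n} {Z : Set ℓ} (g : Fin m → Z) (h : Fin n → Z)
                      (x : Fin m → Carrier) (y : Fin n → Carrier) → m ≥ 1 →
                      (∀ z → ∑ (allFin m) (λ i → when (g i ≟ z) (x i)) ⊑ ∑ (allFin n) (λ j → when (h j ≟ z) (y j))) →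
                      Σ[ u ∈ (Fin m → Fin n → Carrier) ]
                        (∀ j → ∑ (allFin m) (λ i → u i j) ⊑ y j) × (∀ i → ∑ (allFin n) (u i) ≈ x i)
                        × (∀ i j → ¬ (u i j ≈ e) → h j ≡ g i)
      rearrangeOver {m} {n} {Z} g h x y m≥1 x⊑y = u , columns , rows , fibres
        where
        over : ∀ z → Σ[ u ∈ (Fin m → Fin n → Carrier) ]
                       (∀ j → ∑ (allFin m) (λ i → u i j) ⊑ when (h j ≟ z) (y j))
                       × (∀ i → ∑ (allFin n) (u i) ≈ when (g i ≟ z) (x i))
        over z = rearrange _ _ m≥1 (x⊑y z)

        u : Fin m → Fin n → Carrier
        u i = proj₁ (over (g i)) i

        fibres : ∀ i j → ¬ (u i j ≈ e) → h j ≡ g i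
        fibres i j u≉e with h j ≟ g i | proj₁ (proj₂ (over (g i))) j
        ... | yes eq | _   = eq
        -- Column `j` of the family over `g i` is bounded by a bracket that vanishes here, and
        -- positivity passes this bound on to each summand.
        ... | no _   | ⊑e = ⊥-elim (u≉e (⊑e⇒≈e (⊑-trans (summand-⊑ (∈-allFin i)) ⊑e)))

        columns : ∀ j → ∑ (allFin m) (λ i → u i j) ⊑ y j
        columns j = begin
          ∑ (allFin m) (λ i → u i j)                        ≤⟨ ∑-mono (allFin m) (λ i → sameFibre i em) ⟩
          ∑ (allFin m) (λ i → proj₁ (over (h j)) i j)       ≤⟨ proj₁ (proj₂ (over (h j))) j ⟩
          when (h j ≟ h j) (y j)                            ≈⟨ when-yes (h j ≟ h j) refl ⟩
          y j                                               ∎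
          where
          -- Column `j` of `u` mixes families over different points. A non-unit share forces
          -- `h j ≡ g i`, so it comes from the family over `h j`; unit shares are below anything.
          sameFibre : ∀ i → Dec (u i j ≈ e) → u i j ⊑ proj₁ (over (h j)) i j
          sameFibre i (yes u≈e) = ⊑-trans (⊑-reflexive u≈e) (pos _)
          sameFibre i (no u≉e)  = ⊑-reflexive (≈-reflexive
            (≡.cong (λ z → proj₁ (over z) i j) (≡.sym (fibres i j u≉e))))

        rows : ∀ i → ∑ (allFin n) (u i) ≈ x i
        rows i = ≈-trans (proj₂ (proj₂ (over (g i))) i) (when-yes (g i ≟ g i) refl)

  -- A list of entries, ordered by parent, splits each leaf j into one leaf per
  -- entry with parent j; the new leaf is to be sent to the target of its entry.
  record Entry (m : ℕ) (X : Set ℓ) : Set ℓ where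
    constructor entry
    field
      parent : Fin m
      target : X
      label  : NonUnit

    share : Carrier
    share = proj₁ label

  open Entry

  -- Splitting leaves into words and mergings.

  module _ {X : Set ℓ} (l : List⁺ NonUnit) where

    -- The parent map is monotone because the entries are sorted, and surjective because a leaf
    -- without entries would have weight `e`, against its being a `NonUnit`. The last component
    -- transfers bounds on targets from the entries to the new leaves.
    splitByEntries : (ts : List (Entry ∣ l ∣ X)) → AllPairs (λ s t → parent s Fin.≤ parent t) ts →
                     (∀ j → leafWeight l j ≈ ∑ ts (λ t → when (parent t Fin.≟ j) (share t))) →
                     Σ[ l′ ∈ List⁺ NonUnit ] Σ[ s ∈ Merging l′ l ] Σ[ entryAt ∈ (Fin ∣ l′ ∣ → Entry ∣ l ∣ X) ]
                       (∀ i → entryAt i ∈ ts) × (∀ i → parent (entryAt i) ≡ mergeTo s i)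
                       × (∀ {P : X → Set ℓ} (d : ∀ x → Dec (P x)) →
                          ∑ (allFin ∣ l′ ∣) (λ i → when (d (target (entryAt i))) (leafWeight l′ i))
                          ≈ ∑ ts (λ t → when (d (target t)) (share t)))
    splitByEntries []       _      weights≈ = ⊥-elim (proj₂ (lookup (toList l) Fin.zero) (weights≈ Fin.zero))
    splitByEntries ts@(t ∷ ts₀) sorted weights≈ =
      l′ , merging′ , entryAt , origin-∈ label ts , (λ _ → refl) , λ d → ∑-entry (λ t → d (target t))
      where
      l′ : List⁺ NonUnit
      -- With `ts` matched as a cons, `toList l′` computes to `map label ts`, so `origin label ts`
      -- is indexed by the leaves of `l′`.
      l′ = label t ∷ map label ts₀

      entryAt : Fin ∣ l′ ∣ → Entry ∣ l ∣ X
      entryAt = origin label ts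

      ∑-entry : {P : Entry ∣ l ∣ X → Set p} (d : ∀ t → Dec (P t)) →
                ∑ (allFin ∣ l′ ∣) (λ i → when (d (entryAt i)) (leafWeight l′ i)) ≈ ∑ ts (λ t → when (d t) (share t))
      ∑-entry d = ≈-trans
        (∑-cong (allFin ∣ l′ ∣) (λ {i} _ → when-cong (d (entryAt i))
          (≈-reflexive (≡.cong proj₁ (lookup-map-origin label ts i)))))
        (∑-origin label ts)

      weights′ : ∀ j → leafWeight l j ≈ ∑ (allFin ∣ l′ ∣) (λ i → when (parent (entryAt i) Fin.≟ j) (leafWeight l′ i))
      weights′ j = ≈-trans (weights≈ j) (≈-sym (∑-entry (λ t → parent t Fin.≟ j)))

      hit : ∀ j → Σ[ i ∈ Fin ∣ l′ ∣ ] parent (entryAt i) ≡ j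
      hit j with Fin.any? (λ i → parent (entryAt i) Fin.≟ j)
      ... | yes found = found
      ... | no none   = ⊥-elim (proj₂ (lookup (toList l) j) (≈-trans (weights′ j)
        (∑-e (allFin ∣ l′ ∣) (λ {i} _ → when-no (parent (entryAt i) Fin.≟ j) (λ eq → none (i , eq))))))

      merging′ : Merging l′ l
      merging′ = record
        { mergeTo    = λ i → parent (entryAt i)
        ; monotone   = origin-monotone ℕ.≤-refl label ts sorted
        ; surjective = λ j → proj₁ (hit j) , λ { refl → proj₂ (hit j) }
        ; weights    = weights′
        }

  module _ {m n : ℕ} {X : Set ℓ} (x : Fin n → X) (u : Fin m → Fin n → Carrier) where

    entriesAt : Fin m → Fin n → List (Entry m X)
    entriesAt j q = map (entry j (x q)) (nonUnit (em {u j q ≈ e}))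

    row : Fin m → List (Entry m X)
    row j = concatMap (entriesAt j) (allFin n)

    entries : List (Entry m X)
    entries = concatMap row (allFin m)

    ∈-row : ∀ j {t} → t ∈ row j → parent t ≡ j × (Σ[ q ∈ Fin n ] target t ≡ x q × ¬ (u j q ≈ e))
    ∈-row j t∈
      with q , _ , t∈′ ← find (∈-concatMap⁻ (entriesAt j) {xs = allFin n} t∈)
      with κ , κ∈ , refl ← ∈-map⁻ (entry j (x q)) t∈′
      = refl , q , refl , ∈-nonUnit (em {u j q ≈ e}) κ∈

    ∈-entries : ∀ {t} → t ∈ entries → Σ[ q ∈ Fin n ] target t ≡ x q × ¬ (u (parent t) q ≈ e)
    ∈-entries t∈
      with j , _ , t∈′ ← find (∈-concatMap⁻ row {xs = allFin m} t∈)
      with refl , found ← ∈-row j t∈′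
      = found

    -- All entries of one row have the same parent, and the rows are concatenated in increasing
    -- order of it.
    entries-sorted : AllPairs (λ s t → parent s Fin.≤ parent t) entries
    entries-sorted = AllPairs.concat⁺
      (All.map⁺ (All.tabulate (λ {j} _ → allPairs-of-all {P = λ t → parent t ≡ j}
        (λ { refl refl → ℕ.≤-refl }) (All.tabulate (λ t∈ → proj₁ (∈-row j t∈))))))
      (AllPairs.map⁺ (AllPairs.tabulate⁺-< (λ {i} {j} i<j → All.tabulate (λ s∈ → All.tabulate (λ t∈ →
        ≡.subst₂ Fin._≤_ (≡.sym (proj₁ (∈-row i s∈))) (≡.sym (proj₁ (∈-row j t∈))) (ℕ.<⇒≤ i<j))))))

    -- The omitted shares are units, so nothing is lost by leaving them out. Letting the test see
    -- both parent and target yields the row sums and the column sums as instances.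
    ∑-entries : {P : Fin m → X → Set p} (d : ∀ j z → Dec (P j z)) →
                ∑ entries (λ t → when (d (parent t) (target t)) (share t))
                ≈ ∑ (allFin m) (λ j → ∑ (allFin n) (λ q → when (d j (x q)) (u j q)))
    ∑-entries d = ≈-trans (∑-concatMap row (allFin m)) (∑-cong (allFin m) (λ {j} _ →
      ≈-trans (∑-concatMap (entriesAt j) (allFin n)) (∑-cong (allFin n) (λ {q} _ →
      let nu = nonUnit (em {u j q ≈ e}) in begin-equality
        ∑ (entriesAt j q) (λ t → when (d (parent t) (target t)) (share t))
          ≈⟨ ∑-map (entry j (x q)) nu ⟩
        ∑ nu (λ κ → when (d j (x q)) (proj₁ κ))
          ≈⟨ when-∑ (d j (x q)) nu ⟨
        when (d j (x q)) (∑ nu proj₁)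
          ≈⟨ when-cong (d j (x q)) (∑-nonUnit (em {u j q ≈ e})) ⟩
        when (d j (x q)) (u j q)
          ∎))))

    ∑-entries-parent : ∀ i → ∑ entries (λ t → when (parent t Fin.≟ i) (share t)) ≈ ∑ (allFin n) (u i)
    ∑-entries-parent i = begin-equality
      ∑ entries (λ t → when (parent t Fin.≟ i) (share t))
        ≈⟨ ∑-entries (λ j _ → j Fin.≟ i) ⟩
      ∑ (allFin m) (λ j → ∑ (allFin n) (λ q → when (j Fin.≟ i) (u j q)))
        ≈⟨ ∑-cong (allFin m) (λ {j} _ → when-∑ (j Fin.≟ i) (allFin n)) ⟨
      ∑ (allFin m) (λ j → when (j Fin.≟ i) (∑ (allFin n) (u j)))
        ≈⟨ ∑-δ (Unique.allFin⁺ m) (∈-allFin i) (λ j j≢i → when-no (j Fin.≟ i) j≢i) ⟩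
      when (i Fin.≟ i) (∑ (allFin n) (u i))
        ≈⟨ when-yes (i Fin.≟ i) refl ⟩
      ∑ (allFin n) (u i)
        ∎

    ∑-entries-target : ∀ z → ∑ entries (λ t → when (target t ≟ z) (share t))
                             ≈ ∑ (allFin n) (λ q → when (x q ≟ z) (∑ (allFin m) (λ j → u j q)))
    ∑-entries-target z = begin-equality
      ∑ entries (λ t → when (target t ≟ z) (share t))
        ≈⟨ ∑-entries (λ _ y → y ≟ z) ⟩
      ∑ (allFin m) (λ j → ∑ (allFin n) (λ q → when (x q ≟ z) (u j q)))
        ≈⟨ ∑-swap (allFin m) (allFin n) ⟩
      ∑ (allFin n) (λ q → ∑ (allFin m) (λ j → when (x q ≟ z) (u j q)))
        ≈⟨ ∑-cong (allFin n) (λ {q} _ → when-∑ (x q ≟ z) (allFin m)) ⟨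
      ∑ (allFin n) (λ q → when (x q ≟ z) (∑ (allFin m) (λ j → u j q)))
        ∎

  Splitting : {X Z : Set ℓ} → (X → Z) → FinSupp X → (l : List⁺ NonUnit) → (Fin ∣ l ∣ → Z) → Set ℓ
  Splitting {X} f μ l g =
    Σ[ l′ ∈ List⁺ NonUnit ] Σ[ s ∈ Merging l′ l ] Σ[ t ∈ (Fin ∣ l′ ∣ → X) ]
      (∀ i → f (t i) ≡ g (mergeTo s i))
      × (∀ x → ∑ (allFin ∣ l′ ∣) (λ i → when (t i ≟ x) (leafWeight l′ i)) ⊑ weight μ x)

  -- Each of the three properties of the matrix has its own use: the row sums give the weights of
  -- the merging, the column bounds keep the new leaves below `μ`, and the fibre condition places
  -- them over their parents.
  split : PositivelyOrdered K → IsRearrangementMonoid K →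
          {X Z : Set ℓ} (f : X → Z) (μ : FinSupp X) (l : List⁺ NonUnit) (g : Fin ∣ l ∣ → Z) →
          (∀ z → ∑ (allFin ∣ l ∣) (λ j → when (g j ≟ z) (leafWeight l j)) ⊑ weight (push f μ) z) →
          Splitting f μ l g
  split pos rearrangement f μ l g l⊑
    with u , columns , rows , fibres ← rearrangeOver pos rearrangement g (λ q → f (lookup (supportSet μ) q))
           (leafWeight l) (λ q → weight μ (lookup (supportSet μ) q)) (s≤s z≤n)
           -- The fibre sum runs over a list, whereas rearrangement takes families over `Fin`;
           -- positions in the support serve as indices.
           (λ z → ⊑-trans (l⊑ z) (⊑-reflexive (≈-sym (∑-lookup (supportSet μ)))))
    with l′ , s , entryAt , entryAt∈ , parent≡ , ∑-entryAt ←
           splitByEntries l (entries (lookup (supportSet μ)) u) (entries-sorted (lookup (supportSet μ)) u)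
             (λ i → ≈-sym (≈-trans (∑-entries-parent (lookup (supportSet μ)) u i) (rows i)))
    = l′ , s , (λ i → target (entryAt i)) , fibre , bounded
    where
    D = supportSet μ

    fibre : ∀ i → f (target (entryAt i)) ≡ g (mergeTo s i)
    fibre i with q , target≡ , u≉e ← ∈-entries (lookup D) u (entryAt∈ i) =
      ≡.trans (≡.cong f target≡) (≡.trans (fibres (parent (entryAt i)) q u≉e) (≡.cong g (parent≡ i)))

    bounded : ∀ x → ∑ (allFin ∣ l′ ∣) (λ i → when (target (entryAt i) ≟ x) (leafWeight l′ i)) ⊑ weight μ x
    bounded x = begin
      ∑ (allFin ∣ l′ ∣) (λ i → when (target (entryAt i) ≟ x) (leafWeight l′ i))
        ≈⟨ ∑-entryAt (_≟ x) ⟩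
      ∑ (entries (lookup D) u) (λ t → when (target t ≟ x) (share t))
        ≈⟨ ∑-entries-target (lookup D) u x ⟩
      ∑ (allFin (length D)) (λ q → when (lookup D q ≟ x) (∑ (allFin ∣ l ∣) (λ j → u j q)))
        ≤⟨ ∑-mono (allFin (length D)) (λ q → when-mono (lookup D q ≟ x) (columns q)) ⟩
      ∑ (allFin (length D)) (λ q → when (lookup D q ≟ x) (weight μ (lookup D q)))
        ≈⟨ ∑-lookup D ⟩
      -- Selecting `x` from the support is pushing forward along the identity.
      weight (push idf μ) x
        ≈⟨ push-id μ x ⟩
      weight μ x
        ∎

  -- Outgoing weights of paths and fans, pushed along a map of states.

  spine-injective : ∀ {n m} {i j : Fin (suc n)} → spine {n} {m} i ≡ spine j → i ≡ j
  spine-injective refl = refl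

  module _ {X : Set ℓ} (w : Word) (σ : Fin (suc (length w)) → X) (ax : A × X) where

    -- The number `m` of leaves is left free so that the same sum serves paths and fans; the map of
    -- states enters only through its values `σ` on the spine.
    spineSum : ∀ {m} → TreeState (length w) m → Carrier
    spineSum p = ∑ (allFin (length w)) (λ i →
      when (spine (inject₁ i) ≟ p) (when ((letterAt w i , σ (Fin.suc i)) ≟ ax) (weightAt w i)))

    spineSum-inject₁ : ∀ {m} i → spineSum {m} (spine (inject₁ i))
                                 ≈ when ((letterAt w i , σ (Fin.suc i)) ≟ ax) (weightAt w i)
    spineSum-inject₁ {m} i = ≈-trans
      (∑-δ (Unique.allFin⁺ (length w)) (∈-allFin i)
        (λ j j≢i → when-no (state j ≟ state i) (λ eq → j≢i (injective eq))))
      (when-yes (state i ≟ state i) refl)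
      where
      state : Fin (length w) → TreeState (length w) m
      state j = spine (inject₁ j)
      injective : ∀ {j k} → state j ≡ state k → j ≡ k
      injective eq = Fin.inject₁-injective (spine-injective eq)

    spineSum-top : ∀ {m} → spineSum {m} (spine (fromℕ (length w))) ≈ e
    spineSum-top {m} = ∑-e (allFin (length w)) (λ {i} _ →
      when-no (spine (inject₁ i) ≟ spine (fromℕ (length w))) different)
      where
      different : ∀ {i} → ¬ (spine {length w} {m} (inject₁ i) ≡ spine (fromℕ (length w)))
      different eq = Fin.fromℕ≢inject₁ (≡.sym (spine-injective eq))

    spineSum-leaf : ∀ {m} (j : Fin m) → spineSum (leaf j) ≈ e
    spineSum-leaf j = ∑-e (allFin (length w)) (λ {i} _ → when-no (spine (inject₁ i) ≟ leaf j) (λ ()))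

  push-path : {X : Set ℓ} (w : Word) (g : TreeState (length w) 0 → X) → ∀ p ax →
              weight (push (map₂ g) (step (J (path w)) p)) ax ≈ spineSum w (g ∘′ spine) ax p
  push-path w g p ax = ≈-trans (generate-push (map₂ g) (spineTransitions w) p ax) (∑-map (spineTransition w) (allFin (length w)))

  leafSum : {X : Set ℓ} (b : A) (l : List⁺ NonUnit) (t : Fin ∣ l ∣ → X) (ax : A × X) → Carrier
  leafSum b l t ax = ∑ (allFin ∣ l ∣) (λ j → when ((b , t j) ≟ ax) (leafWeight l j))

  push-fan : {X : Set ℓ} (w : Word) (b : A) (l : List⁺ NonUnit) (g : TreeState (length w) ∣ l ∣ → X) → ∀ p ax →
             weight (push (map₂ g) (step (J (fan w b l)) p)) ax
             ≈ spineSum w (g ∘′ spine) ax p + when (spine (fromℕ (length w)) ≟ p) (leafSum b l (g ∘′ leaf) ax)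
  push-fan {X} w b l g p ax = begin-equality
    weight (push (map₂ g) (step (J (fan w b l)) p)) ax
      ≈⟨ generate-push (map₂ g) (spineTransitions w ++ leafTransitions n b l) p ax ⟩
    ∑ (spineTransitions w ++ leafTransitions n b l) summand
      ≈⟨ ∑-++ (spineTransitions w) (leafTransitions n b l) ⟩
    ∑ (spineTransitions w) summand + ∑ (leafTransitions n b l) summand
      ≈⟨ +-cong (∑-map (spineTransition w) (allFin n)) (∑-map (leafTransition n b l) (allFin ∣ l ∣)) ⟩
    spineSum w (g ∘′ spine) ax p + ∑ (allFin ∣ l ∣) (λ j → summand (leafTransition n b l j))
      -- All leaf transitions have the same source, so the test on it leaves the sum.
      ≈⟨ +-congˡ (when-∑ (spine (fromℕ n) ≟ p) (allFin ∣ l ∣)) ⟨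
    spineSum w (g ∘′ spine) ax p + when (spine (fromℕ n) ≟ p) (leafSum b l (g ∘′ leaf) ax)
      ∎
    where
    n = length w
    summand : Transition (TreeState n ∣ l ∣) → Carrier
    summand (s , bz , k) = when (s ≟ p) (when (map₂ g bz ≟ ax) k)

  push-fan-top : {X : Set ℓ} (w : Word) (b : A) (l : List⁺ NonUnit) (g : TreeState (length w) ∣ l ∣ → X) → ∀ ax →
                 weight (push (map₂ g) (step (J (fan w b l)) (spine (fromℕ (length w))))) ax ≈ leafSum b l (g ∘′ leaf) ax
  push-fan-top w b l g ax = begin-equality
    weight (push (map₂ g) (step (J (fan w b l)) top)) ax
      ≈⟨ push-fan w b l g top ax ⟩
    spineSum w (g ∘′ spine) ax top + when (top ≟ top) (leafSum b l (g ∘′ leaf) ax)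
      ≈⟨ +-cong (spineSum-top w (g ∘′ spine) ax) (when-yes (top ≟ top) refl) ⟩
    e + leafSum b l (g ∘′ leaf) ax
      ≈⟨ +-identityˡ _ ⟩
    leafSum b l (g ∘′ leaf) ax
      ∎
    where
    top = spine (fromℕ (length w))

  -- Take the fan over the empty word with one leaf of weight `k`. The path has weight `e` from the
  -- root to that leaf, the fan has weight `k`, and laxness of the inclusion compares the two.
  inclusionsAreLax⇒positive : InclusionsAreLax → A → PositivelyOrdered K
  inclusionsAreLax⇒positive incl b k with em {k ≈ e}
  ... | yes k≈e = ⊑-reflexive (≈-sym k≈e)
  ... | no k≉e  = begin
    e                                                                 ≈⟨ push-path [] include (spine Fin.zero) ax ⟨
    weight (push (map₂ include) (step (J (path [])) (spine Fin.zero))) ax ≤⟨ incl [] b l (spine Fin.zero) ax ⟩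
    weight (step (J (fan [] b l)) (spine Fin.zero)) ax            ≈⟨ push-id (step (J (fan [] b l)) (spine Fin.zero)) ax ⟨
    weight (push idf (step (J (fan [] b l)) (spine Fin.zero))) ax ≈⟨ push-fan-top [] b l idf ax ⟩
    leafSum b l leaf ax                                           ≈⟨ +-identityʳ _ ⟩
    when (ax ≟ ax) k                                          ≈⟨ when-yes (ax ≟ ax) refl ⟩
    k                                                                 ∎
    where
    l : List⁺ NonUnit
    l = (k , k≉e) ∷ []
    ax : A × TreeState 0 1
    ax = b , leaf Fin.zero

  -- Constructing lax homomorphisms out of paths and fans.

  module _ (pos : PositivelyOrdered K) {X : PointedCoalgebra} where

    -- Laxness comes down to one inequality per edge, since all remaining weights are `e` and `e` is
    -- least.
    pathHom : (w : Word) (σ : Fin (suc (length w)) → State X) → σ Fin.zero ≡ point X →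
              (∀ i → weightAt w i ⊑ weight (step X (σ (inject₁ i))) (letterAt w i , σ (Fin.suc i))) →
              LaxHom (J (path w)) X
    pathHom w σ σ-point σ-lax = record { fun = act ; fun-point = σ-point ; lax = λ { (spine i) → lax′ i } }
      where
      act : TreeState (length w) 0 → State X
      act (spine i) = σ i
      lax′ : ∀ i ax → weight (push (map₂ act) (step (J (path w)) (spine i))) ax ⊑ weight (step X (σ i)) ax
      lax′ i ax with view i
      ... | ‵fromℕ     = ⊑-trans (⊑-reflexive (≈-trans (push-path w act _ ax) (spineSum-top w σ ax))) (pos _)
      ... | ‵inject₁ j = ⊑-trans (⊑-reflexive (≈-trans (push-path w act _ ax) (spineSum-inject₁ w σ ax j)))
                                 (when-⊑ pos ((letterAt w j , σ (Fin.suc j)) ≟ ax) (λ { refl → σ-lax j }))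

    fanHom : ∀ w b l (x : LaxHom (J (path w)) X) (t : Fin ∣ l ∣ → State X) →
             (∀ ax → leafSum b l t ax ⊑ weight (step X (fun x (spine (fromℕ (length w))))) ax) →
             LaxHom (J (fan w b l)) X
    fanHom w b l x t t-lax = record { fun = act ; fun-point = fun-point x ; lax = lax′ }
      where
      n = length w
      act : TreeState n ∣ l ∣ → State X
      act (spine i) = fun x (spine i)
      act (leaf j)  = t j
      σ = act ∘′ spine
      lax′ : ∀ p ax → weight (push (map₂ act) (step (J (fan w b l)) p)) ax ⊑ weight (step X (act p)) ax
      lax′ (leaf j) ax = begin
        weight (push (map₂ act) (step (J (fan w b l)) (leaf j))) ax
          ≈⟨ push-fan w b l act (leaf j) ax ⟩
        spineSum w σ ax (leaf j) + when (spine (fromℕ n) ≟ leaf j) (leafSum b l t ax)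
          ≈⟨ +-cong (spineSum-leaf w σ ax j) (when-no (spine (fromℕ n) ≟ leaf j) (λ ())) ⟩
        e + e
          ≈⟨ +-identityˡ e ⟩
        e
          ≤⟨ pos _ ⟩
        weight (step X (t j)) ax
          ∎
      lax′ (spine i) ax with view i
      ... | ‵fromℕ     = ⊑-trans (⊑-reflexive (push-fan-top w b l act ax)) (t-lax ax)
      -- Before the branching state the fan has the same outgoing weights as the path, so laxness of
      -- `x` applies.
      ... | ‵inject₁ j = begin
        weight (push (map₂ act) (step (J (fan w b l)) (spine (inject₁ j)))) ax
          ≈⟨ push-fan w b l act (spine (inject₁ j)) ax ⟩
        spineSum w σ ax (spine (inject₁ j)) + when (spine (fromℕ n) ≟ spine (inject₁ j)) (leafSum b l t ax)
          ≈⟨ +-cong (spineSum-inject₁ w σ ax j)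
               (when-no (spine (fromℕ n) ≟ spine (inject₁ j)) (λ eq → Fin.fromℕ≢inject₁ (spine-injective eq))) ⟩
        when ((letterAt w j , σ (Fin.suc j)) ≟ ax) (weightAt w j) + e
          ≈⟨ +-identityʳ _ ⟩
        when ((letterAt w j , σ (Fin.suc j)) ≟ ax) (weightAt w j)
          ≈⟨ spineSum-inject₁ w σ ax j ⟨
        spineSum w σ ax (spine (inject₁ j))
          ≈⟨ push-path w (fun x) (spine (inject₁ j)) ax ⟨
        weight (push (map₂ (fun x)) (step (J (path w)) (spine (inject₁ j)))) ax
          ≤⟨ lax x (spine (inject₁ j)) ax ⟩
        weight (step X (σ (inject₁ j))) ax
          ∎

  -- Open maps are proper at reachable states.

  open⇒properAt : (pos : PositivelyOrdered K) {X Y : PointedCoalgebra} (f : LaxHom X Y) →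
                  IsOpen (openMapData (positive⇒inclusionsAreLax pos)) f →
                  ∀ {p} → IsReachableState X p → ∀ ay →
                  weight (push (map₂ (fun f)) (step X p)) ay ≈ weight (step Y (fun f p)) ay
  open⇒properAt pos {X} {Y} f f-open {p} (w , x , refl) (b , y) = ⊑-antisym (lax f p (b , y)) (bound em)
    where
    k = weight (step Y (fun f p)) (b , y)
    bound : Dec (k ≈ e) → k ⊑ weight (push (map₂ (fun f)) (step X p)) (b , y)
    -- A unit weight cannot label a leaf, but it lies below everything.
    bound (yes k≈e) = ⊑-trans (⊑-reflexive k≈e) (pos _)
    bound (no k≉e)  = lifted (f-open (branch {w} {b} {l}) x y⁺ (λ { (spine _) → refl }))
      where
      l : List⁺ NonUnit
      l = (k , k≉e) ∷ []
      y⁺ : LaxHom (J (fan w b l)) Y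
      y⁺ = fanHom pos w b l (f ∘ᴸ x) (λ _ → y) (λ ay → ⊑-trans (⊑-reflexive (+-identityʳ _))
             (when-⊑ pos ((b , y) ≟ ay) (λ { refl → ⊑-refl })))
      Fin1-≡ : (i j : Fin 1) → i ≡ j
      Fin1-≡ Fin.zero Fin.zero = refl
      lifted : _ → k ⊑ weight (push (map₂ (fun f)) (step X p)) (b , y)
      -- The codomain of `s` is a fan, so its domain is a fan with the same word and letter, and
      -- `branch` is the only morphism of `E-K` from the path to it.
      lifted (fan _ _ l′ , branch , merge s , x′ , _ , x′-extends , x′-over) = begin
        k
          ≈⟨ weights s Fin.zero ⟩
        ∑ (allFin ∣ l′ ∣) (λ j → when (mergeTo s j Fin.≟ Fin.zero) (leafWeight l′ j))
          -- As `l` has a single leaf, every leaf of `l′` merges into it and lies over `y`; both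
          -- tests hold for all `j`.
          ≈⟨ ∑-cong (allFin ∣ l′ ∣) (λ {j} _ → when-⇔ (mergeTo s j Fin.≟ Fin.zero) ((b , fun f (fun x′ (leaf j))) ≟ (b , y))
               (λ _ → ≡.cong (b ,_) (x′-over (leaf j))) (λ _ → Fin1-≡ _ _) ≈-refl) ⟩
        leafSum b l′ (λ j → fun f (fun x′ (leaf j))) (b , y)
          ≈⟨ push-fan-top w b l′ (fun f ∘′ fun x′) (b , y) ⟨
        weight (push (map₂ (fun f ∘′ fun x′)) (step (J (fan w b l′)) top)) (b , y)
          ≈⟨ push-∘ (map₂ (fun f)) (map₂ (fun x′)) (step (J (fan w b l′)) top) (b , y) ⟩
        weight (push (map₂ (fun f)) (push (map₂ (fun x′)) (step (J (fan w b l′)) top))) (b , y)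
          ≤⟨ push-mono (map₂ (fun f)) (push (map₂ (fun x′)) (step (J (fan w b l′)) top)) (step X (fun x′ top)) (lax x′ top) (b , y) ⟩
        weight (push (map₂ (fun f)) (step X (fun x′ top))) (b , y)
          ≡⟨ ≡.cong (λ q → weight (push (map₂ (fun f)) (step X q)) (b , y)) (x′-extends top₀) ⟩
        weight (push (map₂ (fun f)) (step X p)) (b , y)
          ∎
        where
        top : TreeState (length w) ∣ l′ ∣
        top = spine (fromℕ (length w))
        top₀ : TreeState (length w) 0
        top₀ = spine (fromℕ (length w))

  -- Proper homomorphisms are open.

  fanLift : PositivelyOrdered K → IsRearrangementMonoid K →
            {X Y : PointedCoalgebra} (f : LaxHom X Y) → IsProper f →
            ∀ w b l (x : LaxHom (J (path w)) X) (y : LaxHom (J (fan w b l)) Y) →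
            (∀ i → fun y (spine i) ≡ fun f (fun x (spine i))) →
            Σ[ l′ ∈ List⁺ NonUnit ] Σ[ s ∈ Merging l′ l ] Σ[ x′ ∈ LaxHom (J (fan w b l′)) X ]
              (∀ i → fun x′ (spine i) ≡ fun x (spine i)) × (∀ j → fun f (fun x′ (leaf j)) ≡ fun y (leaf (mergeTo s j)))
  fanLift pos rearrangement {X} {Y} f f-proper w b l x y square =
    lift (split pos rearrangement (map₂ (fun f)) (step X (fun x (spine top))) l (λ j → b , fun y (leaf j)) leaves-⊑)
    where
    top = fromℕ (length w)

    leaves-⊑ : ∀ ay → leafSum b l (fun y ∘′ leaf) ay ⊑ weight (push (map₂ (fun f)) (step X (fun x (spine top)))) ay
    leaves-⊑ ay = begin
      leafSum b l (fun y ∘′ leaf) ay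
        ≈⟨ push-fan-top w b l (fun y) ay ⟨
      weight (push (map₂ (fun y)) (step (J (fan w b l)) (spine top))) ay
        ≤⟨ lax y (spine top) ay ⟩
      weight (step Y (fun y (spine top))) ay
        ≡⟨ ≡.cong (λ q → weight (step Y q) ay) (square top) ⟩
      weight (step Y (fun f (fun x (spine top)))) ay
        ≈⟨ f-proper (fun x (spine top)) ay ⟨
      weight (push (map₂ (fun f)) (step X (fun x (spine top)))) ay
        ∎

    lift : Splitting (map₂ (fun f)) (step X (fun x (spine top))) l (λ j → b , fun y (leaf j)) →
           Σ[ l′ ∈ List⁺ NonUnit ] Σ[ s ∈ Merging l′ l ] Σ[ x′ ∈ LaxHom (J (fan w b l′)) X ]
             (∀ i → fun x′ (spine i) ≡ fun x (spine i)) × (∀ j → fun f (fun x′ (leaf j)) ≡ fun y (leaf (mergeTo s j)))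
    lift (l′ , s , t , t-over , t-lax) =
      l′ , s , fanHom pos w b l′ x (proj₂ ∘′ t) t-lax′ , (λ _ → refl) , (λ j → ≡.cong proj₂ (t-over j))
      where
      t-lax′ : ∀ ax → leafSum b l′ (proj₂ ∘′ t) ax ⊑ weight (step X (fun x (spine top))) ax
      t-lax′ ax = ⊑-trans
        -- The splitting took place in `A × State X`, and `map₂ (fun f)` preserves letters, so every
        -- lifted transition has letter `b`.
        (⊑-reflexive (∑-cong (allFin ∣ l′ ∣) (λ {j} _ → ≈-reflexive
          (≡.cong (λ c → when ((c , proj₂ (t j)) ≟ ax) (leafWeight l′ j)) (≡.sym (≡.cong proj₁ (t-over j)))))))
        (t-lax ax)

  proper⇒open : (incl : InclusionsAreLax) → IsRearrangementMonoid K →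
                {X Y : PointedCoalgebra} (f : LaxHom X Y) → IsProper f → IsOpen (openMapData incl) f
  proper⇒open incl rearrangement f f-proper {v} idᴱ x y square =
    -- Over an identity the square says that `y` is `f ∘ᴸ x`, so `x` is its own lift.
    v , idᴱ , idˢ , x , JS-id , (λ _ → refl) , λ p → ≡.trans (≡.sym (square p)) (≡.cong (fun y) (≡.sym (JS-id p)))
    where
    JS-id : ∀ p → fun (JS-map (idˢ {v})) p ≡ p
    JS-id = FunctorOver.F-id JS-K {v}
  proper⇒open incl rearrangement f f-proper (branch {w} {b} {l}) x y square =
    fan w b l′ , branch , merge s , x′ , (λ { (spine _) → refl }) , (λ { (spine i) → extends i })
    , λ { (spine i) → ≡.trans (≡.cong (fun f) (extends i)) (≡.sym (square (spine i))) ; (leaf j) → over j }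
    where
    -- The letter `b` of the fan witnesses that `A` is inhabited, and so laxness of the inclusions
    -- yields positivity.
    lifted = fanLift (inclusionsAreLax⇒positive incl b) rearrangement f f-proper w b l x y (λ i → square (spine i))
    l′ = proj₁ lifted
    s = proj₁ (proj₂ lifted)
    x′ = proj₁ (proj₂ (proj₂ lifted))
    extends = proj₁ (proj₂ (proj₂ (proj₂ lifted)))
    over = proj₂ (proj₂ (proj₂ (proj₂ lifted)))

  -- The reachable part of a coalgebra.

  module _ (X : PointedCoalgebra) where

    -- Accessibility through `Star` is closed under successors by appending one step; lax
    -- homomorphisms out of paths are extracted from it only afterwards.
    _⟶_ : Rel (State X) ℓ
    p ⟶ q = Σ[ b ∈ A ] ¬ (weight (step X p) (b , q) ≈ e)

    -- Each edge is given the full weight of its transition in `X`, so the required inequalities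
    -- hold by reflexivity.
    walk : ∀ {p q} → Star _⟶_ p q →
           Σ[ w ∈ Word ] Σ[ σ ∈ (Fin (suc (length w)) → State X) ]
             σ Fin.zero ≡ p × σ (fromℕ (length w)) ≡ q
             × (∀ i → weightAt w i ⊑ weight (step X (σ (inject₁ i))) (letterAt w i , σ (Fin.suc i)))
    walk {p} ε = [] , (λ _ → p) , refl , refl , λ ()
    walk {p} ((b , ≉e) ◅ rest) with w , σ , refl , σ-end , σ-lax ← walk rest =
      (b , _ , ≉e) ∷ w , (λ { Fin.zero → p ; (Fin.suc i) → σ i }) , refl , σ-end
      , λ { Fin.zero → ⊑-refl ; (Fin.suc i) → σ-lax i }

    star⇒reachable : PositivelyOrdered K → ∀ {p} → Star _⟶_ (point X) p → IsReachableState X p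
    star⇒reachable pos steps with w , σ , σ-point , σ-end , σ-lax ← walk steps =
      w , pathHom pos w σ σ-point σ-lax , σ-end

    accessible? : ∀ p → Dec (Star _⟶_ (point X) p)
    accessible? _ = em

    -- Through True, membership in the reachable part is a proposition.
    ReachableState : Set ℓ
    ReachableState = Σ[ p ∈ State X ] True (accessible? p)

    ReachableState-≡ : {p q : ReachableState} → proj₁ p ≡ proj₁ q → p ≡ q
    ReachableState-≡ {p , _} refl = ≡.cong (p ,_) (T-irrelevant _ _)

    successor : (p : ReachableState) → ∀ {b q} → ¬ (weight (step X (proj₁ p)) (b , q) ≈ e) → True (accessible? q)
    successor (p , acc) {b} {q} ≉e = fromWitness {a? = accessible? q} (toWitness {a? = accessible? p} acc ◅◅ ((b , ≉e) ◅ ε))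

    reachableLifts : A × State X → List (A × ReachableState)
    reachableLifts (b , q) = map (λ acc → b , q , acc) (decidedBy (accessible? q))

    reachablePart : PointedCoalgebra
    reachablePart = record
      { State = ReachableState
      ; step  = λ (p , _) → record
        { weight  = λ bq → weight (step X p) (map₂ proj₁ bq)
        ; support = concatMap reachableLifts (support (step X p))
        ; covers  = λ {bq} ≉e → ∈-concatMap⁺ reachableLifts
            (lose (covers (step X p) ≉e) (∈-map⁺ _ (∈-decidedBy (accessible? _) (proj₂ (proj₂ bq)))))
        }
      ; point = point X , fromWitness {a? = accessible? (point X)} ε
      }

    -- A non-unit transition from an accessible state ends in an accessible state, so its target has
    -- a lift, and only one. If the weight is a unit, every lift contributes `e`.
    reachablePart-weight : ∀ p bq → weight (push (map₂ proj₁) (step reachablePart p)) bq ≈ weight (step X (proj₁ p)) bq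
    reachablePart-weight p (b , q) with em {weight (step X (proj₁ p)) (b , q) ≈ e}
    ... | yes ≈e = ≈-trans (∑-e (supportSet μ) (λ {z} _ → vanish z)) (≈-sym ≈e)
      where
      μ = step reachablePart p
      vanish : ∀ z → when (map₂ proj₁ z ≟ (b , q)) (weight μ z) ≈ e
      vanish z with map₂ proj₁ z ≟ (b , q)
      ... | yes refl = ≈e
      ... | no _     = ≈-refl
    ... | no ≉e = ≈-trans
      (∑-δ (supportSet-! μ) (∈-deduplicate⁺ _≟_ (covers μ {z₀} ≉e))
        (λ z z≢ → when-no (map₂ proj₁ z ≟ (b , q)) (λ eq → z≢ (injective eq))))
      (when-yes (map₂ proj₁ z₀ ≟ (b , q)) refl)
      where
      μ = step reachablePart p
      z₀ : A × ReachableState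
      z₀ = b , q , successor p ≉e
      injective : ∀ {z} → map₂ proj₁ z ≡ (b , q) → z ≡ z₀
      injective {_ , z} eq with refl ← ≡.cong proj₁ eq = ≡.cong (b ,_) (ReachableState-≡ (≡.cong proj₂ eq))

    inclusion : LaxHom reachablePart X
    inclusion = record
      { fun = proj₁ ; fun-point = refl ; lax = λ p bq → ⊑-reflexive (reachablePart-weight p bq) }

  -- Openness is applied to `f` on all of `X`, one accessible state at a time, so openness of the
  -- restriction is never at issue.
  open∘inclusion-proper : (pos : PositivelyOrdered K) {X Y : PointedCoalgebra} (f : LaxHom X Y) →
                          IsOpen (openMapData (positive⇒inclusionsAreLax pos)) f → IsProper (f ∘ᴸ inclusion X)
  open∘inclusion-proper pos {X} {Y} f f-open p@(p₀ , acc) by = begin-equality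
    weight (push (map₂ (fun f ∘′ proj₁)) μ) by
      ≈⟨ push-∘ (map₂ (fun f)) (map₂ proj₁) μ by ⟩
    weight (push (map₂ (fun f)) (push (map₂ proj₁) μ)) by
      ≈⟨ push-cong ⟩
    weight (push (map₂ (fun f)) (step X p₀)) by
      ≈⟨ open⇒properAt pos f f-open (star⇒reachable X pos (toWitness {a? = accessible? X p₀} acc)) by ⟩
    weight (step Y (fun f p₀)) by
      ∎
    where
    μ = step (reachablePart X) p
    push-cong : weight (push (map₂ (fun f)) (push (map₂ proj₁) μ)) by ≈ weight (push (map₂ (fun f)) (step X p₀)) by
    -- Pushing forward respects equality of weights because it is monotone in both directions.
    push-cong = ⊑-antisym
      (push-mono (map₂ (fun f)) (push (map₂ proj₁) μ) (step X p₀) (λ z → ⊑-reflexive (reachablePart-weight X p z)) by)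
      (push-mono (map₂ (fun f)) (step X p₀) (push (map₂ proj₁) μ) (λ z → ⊑-reflexive (≈-sym (reachablePart-weight X p z))) by)

-- Open versus proper homomorphisms, and the two notions of bisimilarity.

theorem5p6 : {ℓ : Level} (em : ExcludedMiddle ℓ) (A : Set ℓ) (K : OrderedCommutativeMonoid ℓ) →
    let open Theory em A K in
    ((X Y : PointedCoalgebra) (f : LaxHom X Y) →
    ((pos : PositivelyOrdered K) → IsOpen (openMapData (positive⇒inclusionsAreLax pos)) f → IsReachable X → IsProper f)
    × ((incl : InclusionsAreLax) → IsProper f → IsRearrangementMonoid K → IsOpen (openMapData incl) f))
    × ((pos : PositivelyOrdered K) → IsRearrangementMonoid K → (X Y : PointedCoalgebra) →
    Bisimilar (openMapData (positive⇒inclusionsAreLax pos)) X Y ⇔ CoalgebraicallyBisimilar X Y)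
theorem5p6 em A K =
  (λ X Y f →
    (λ pos f-open reachable p → open⇒properAt em A K pos f f-open (reachable p))
    , λ incl f-proper rearrangement {v} {w} → proper⇒open em A K incl rearrangement f f-proper {v} {w})
  , λ pos rearrangement X Y → mk⇔
    (λ (Z , (f , f-open) , (g , g-open)) →
      let open Theory em A K in
      reachablePart em A K Z
      , (f ∘ᴸ inclusion em A K Z , open∘inclusion-proper em A K pos f f-open)
      , (g ∘ᴸ inclusion em A K Z , open∘inclusion-proper em A K pos g g-open))
    -- In this direction the apex is kept, since properness gives openness of the legs on all of
    -- `Z`.
    (λ (Z , (f , f-proper) , (g , g-proper)) →
      let incl = Theory.positive⇒inclusionsAreLax em A K pos in
      Z
      , (f , λ {v} {w} → proper⇒open em A K incl rearrangement f f-proper {v} {w})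
      , (g , λ {v} {w} → proper⇒open em A K incl rearrangement g g-proper {v} {w}))
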